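{- For every real number $a$ such that $a>1$ and every positive real number $\lambda$, the function $f:\mathbb{R}_+\to\mathbb{R}$ defined by $f(x)=a^{\lambda x}-1$ belongs to the class $\mathcal{F}$.
   Context: $\mathbb{N}=\{0,1,2,\dots\}$ and $\mathbb{R}_+=[0,\infty)$. The class $\mathcal{F}$ consists of all real-valued functions $f$ whose domain contains $\mathbb{N}$ and such that $f(0)=0$, $f(k+2)-f(k+1)>f(k+1)-f(k)$ for all $k\in\mathbb{N}$, and $(k-2)f(k)\ge k\,(f(k-1)-f(1))$ for all integers $k\ge 3$. -}

module Defs where

open import Algebra.Bundles using (CommutativeRing)
open import Data.Fin.Base using (toℕ)
open import Data.Integer.Base as ℤ using (ℤ)
import Data.Integer.Properties as ℤ
open import Data.Nat.Base as ℕ using (ℕ; zero; suc)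
open import Data.Nat.Coprimality using (1-coprimeTo)
import Data.Nat.Coprimality as Coprime
import Data.Nat.Properties as ℕ
open import Data.Product using (∃; _×_; _,_; proj₁; proj₂)
open import Data.Rational
open import Data.Rational.Properties
open import Data.Sum.Base using (inj₁; inj₂)
open import Relation.Binary.PropositionalEquality
open import Relation.Nullary.Decidable using (dec⇒maybe)
open import Tactic.RingSolver using (solve-∀)
open import Tactic.RingSolver.Core.AlmostCommutativeRing
  using (AlmostCommutativeRing; fromCommutativeRing)
open import Algebra.Definitions.RawSemiring +-*-rawSemiring using (_^_; sum)
open import Algebra.Properties.Semiring.Exp
  (CommutativeRing.semiring +-*-commutativeRing) using (^-assocʳ)

private
  ring : AlmostCommutativeRing _ _
  ring = fromCommutativeRing +-*-commutativeRing (λ x → dec⇒maybe (0ℚ ≟ x))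

ι : ℕ → ℚ
ι n = ℤ.+ n / 1

-- Indexed so that the denominator is never zero: inv n = 1/(n + 1).
inv : ℕ → ℚ
inv n = ℤ.+ 1 / suc n

∑< : ℕ → (ℕ → ℚ) → ℚ
∑< n f = sum {n} (λ i → f (toℕ i))

0≤1 : 0ℚ ≤ 1ℚ
0≤1 = nonNegative⁻¹ 1ℚ

0<1 : 0ℚ < 1ℚ
0<1 = positive⁻¹ 1ℚ

+-nonneg : ∀ {p q} → 0ℚ ≤ p → 0ℚ ≤ q → 0ℚ ≤ p + q
+-nonneg {p} {q} a b = subst (_≤ p + q) (+-identityˡ 0ℚ) (+-mono-≤ a b)

+-pos-nonneg : ∀ {p q} → 0ℚ < p → 0ℚ ≤ q → 0ℚ < p + q
+-pos-nonneg {p} {q} a b = subst (_< p + q) (+-identityˡ 0ℚ) (+-mono-<-≤ a b)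

*-mono-≤ : ∀ {p p′ q q′} → 0ℚ ≤ p → 0ℚ ≤ q → p ≤ p′ → q ≤ q′ → p * q ≤ p′ * q′
*-mono-≤ {p} {p′} {q} 0≤p 0≤q p≤p′ q≤q′ = ≤-trans
  (*-monoʳ-≤-nonNeg q {{nonNegative 0≤q}} p≤p′)
  (*-monoˡ-≤-nonNeg p′ {{nonNegative (≤-trans 0≤p p≤p′)}} q≤q′)

*-nonneg : ∀ {p q} → 0ℚ ≤ p → 0ℚ ≤ q → 0ℚ ≤ p * q
*-nonneg {p} {q} a b = subst (_≤ p * q) (*-zeroʳ p) (*-monoˡ-≤-nonNeg p {{nonNegative a}} b)

*-pos : ∀ {p q} → 0ℚ < p → 0ℚ < q → 0ℚ < p * q
*-pos {p} {q} a b = subst (_< p * q) (*-zeroʳ p) (*-monoʳ-<-pos p {{positive a}} b)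

p≤p+q : ∀ {p q} → 0ℚ ≤ q → p ≤ p + q
p≤p+q {p} {q} h = subst (_≤ p + q) (+-identityʳ p) (+-monoʳ-≤ p h)

p≤q+p : ∀ {p q} → 0ℚ ≤ q → p ≤ q + p
p≤q+p {p} {q} h = subst (p ≤_) (+-comm p q) (p≤p+q h)

0≤q-p : ∀ {p q} → p ≤ q → 0ℚ ≤ q - p
0≤q-p {p} {q} h = subst (_≤ q - p) (+-inverseʳ p) (+-monoˡ-≤ (- p) h)

p≤∣p∣ : ∀ p → p ≤ ∣ p ∣
p≤∣p∣ p with ≤-total 0ℚ p
... | inj₁ h = ≤-reflexive (sym (0≤p⇒∣p∣≡p h))
... | inj₂ h = ≤-trans h (0≤∣p∣ p)

∣p-r∣≤∣p-q∣+∣q-r∣ : ∀ p q r → ∣ p - r ∣ ≤ ∣ p - q ∣ + ∣ q - r ∣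
∣p-r∣≤∣p-q∣+∣q-r∣ p q r = subst (λ t → ∣ t ∣ ≤ ∣ p - q ∣ + ∣ q - r ∣) (lem p q r) (∣p+q∣≤∣p∣+∣q∣ (p - q) (q - r))
  where
  lem : ∀ p q r → (p - q) + (q - r) ≡ p - r
  lem = solve-∀ ring

∣p-q∣≡∣q-p∣ : ∀ p q → ∣ p - q ∣ ≡ ∣ q - p ∣
∣p-q∣≡∣q-p∣ p q = trans (sym (∣-p∣≡∣p∣ (p - q))) (cong ∣_∣ (lem p q))
  where
  lem : ∀ p q → - (p - q) ≡ q - p
  lem = solve-∀ ring

ι-mkℚ : ∀ n → ι n ≡ mkℚ (ℤ.+ n) 0 (Coprime.sym (1-coprimeTo n))
ι-mkℚ n = normalize-coprime (Coprime.sym (1-coprimeTo n))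

inv-mkℚ : ∀ n → inv n ≡ mkℚ (ℤ.+ 1) n (1-coprimeTo (suc n))
inv-mkℚ n = normalize-coprime (1-coprimeTo (suc n))

ι-suc : ∀ n → ι (suc n) ≡ 1ℚ + ι n
ι-suc n = sym (trans (cong (1ℚ +_) (ι-mkℚ n))
  (cong (λ k → (ℤ.+ 1 ℤ.+ k) / 1) (ℤ.*-identityʳ (ℤ.+ n))))

ι-+ : ∀ m n → ι (m ℕ.+ n) ≡ ι m + ι n
ι-+ zero    n = sym (+-identityˡ (ι n))
ι-+ (suc m) n = begin
  ι (suc (m ℕ.+ n))    ≡⟨ ι-suc (m ℕ.+ n) ⟩
  1ℚ + ι (m ℕ.+ n)     ≡⟨ cong (1ℚ +_) (ι-+ m n) ⟩
  1ℚ + (ι m + ι n)     ≡⟨ sym (+-assoc 1ℚ (ι m) (ι n)) ⟩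
  (1ℚ + ι m) + ι n     ≡⟨ cong (_+ ι n) (sym (ι-suc m)) ⟩
  ι (suc m) + ι n      ∎ where open ≡-Reasoning

ι-* : ∀ m n → ι (m ℕ.* n) ≡ ι m * ι n
ι-* zero    n = sym (*-zeroˡ (ι n))
ι-* (suc m) n = begin
  ι (n ℕ.+ m ℕ.* n)      ≡⟨ ι-+ n (m ℕ.* n) ⟩
  ι n + ι (m ℕ.* n)      ≡⟨ cong (λ t → ι n + t) (ι-* m n) ⟩
  ι n + ι m * ι n        ≡⟨ lem (ι m) (ι n) ⟩
  (1ℚ + ι m) * ι n       ≡⟨ cong (_* ι n) (sym (ι-suc m)) ⟩
  ι (suc m) * ι n        ∎
  where
  open ≡-Reasoning
  lem : ∀ a b → b + a * b ≡ (1ℚ + a) * b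
  lem = solve-∀ ring

0≤ι : ∀ n → 0ℚ ≤ ι n
0≤ι zero    = ≤-refl
0≤ι (suc n) = subst (0ℚ ≤_) (sym (ι-suc n)) (+-nonneg 0≤1 (0≤ι n))

0<ι : ∀ n → 0ℚ < ι (suc n)
0<ι n = subst (0ℚ <_) (sym (ι-suc n)) (+-pos-nonneg 0<1 (0≤ι n))

ι-mono : ∀ {m n} → m ℕ.≤ n → ι m ≤ ι n
ι-mono {m} {n} m≤n = subst (ι m ≤_)
  (trans (sym (ι-+ m (n ℕ.∸ m))) (cong ι (ℕ.m+[n∸m]≡n m≤n))) (p≤p+q (0≤ι (n ℕ.∸ m)))

0≤inv : ∀ n → 0ℚ ≤ inv n
0≤inv n = subst (0ℚ ≤_) (sym (inv-mkℚ n)) (nonNegative⁻¹ _)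

ι*inv : ∀ n → ι (suc n) * inv n ≡ 1ℚ
ι*inv n = trans (cong₂ _*_ (ι-mkℚ (suc n)) (inv-mkℚ n))
  (*-inverseʳ (mkℚ (ℤ.+ suc n) 0 (Coprime.sym (1-coprimeTo (suc n)))))

inv-* : ∀ m n → inv (n ℕ.+ m ℕ.* suc n) ≡ inv m * inv n
inv-* m n = begin
  k                                          ≡⟨ lem₁ k ⟩
  1ℚ * (1ℚ * k)                              ≡⟨ cong₂ (λ s t → s * (t * k)) (sym (ι*inv m)) (sym (ι*inv n)) ⟩
  ι (suc m) * inv m * (ι (suc n) * inv n * k) ≡⟨ lem₂ (ι (suc m)) (inv m) (ι (suc n)) (inv n) k ⟩
  inv m * inv n * (ι (suc m) * ι (suc n) * k) ≡⟨ cong (λ t → inv m * inv n * (t * k)) (sym (ι-* (suc m) (suc n))) ⟩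
  inv m * inv n * (ι (suc m ℕ.* suc n) * k)  ≡⟨ cong (inv m * inv n *_) (ι*inv (n ℕ.+ m ℕ.* suc n)) ⟩
  inv m * inv n * 1ℚ                         ≡⟨ *-identityʳ _ ⟩
  inv m * inv n                              ∎
  where
  open ≡-Reasoning
  k = inv (n ℕ.+ m ℕ.* suc n)
  lem₁ : ∀ k → k ≡ 1ℚ * (1ℚ * k)
  lem₁ = solve-∀ ring
  lem₂ : ∀ a b c d k → a * b * (c * d * k) ≡ b * d * (a * c * k)
  lem₂ = solve-∀ ring

abstract
  archimedean : ∀ p → ∃ λ N → p < ι N
  archimedean p@(mkℚ a d _) = suc ℤ.∣ a ∣ , subst (p <_) (sym (ι-mkℚ (suc ℤ.∣ a ∣))) (*<* (begin-strict
    a ℤ.* ℤ.+ 1                      ≡⟨ ℤ.*-identityʳ a ⟩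
    a                              ≤⟨ i≤∣i∣ a ⟩
    ℤ.+ ℤ.∣ a ∣                      <⟨ ℤ.+<+ (ℕ.n<1+n _) ⟩
    ℤ.+ suc ℤ.∣ a ∣                  ≤⟨ ℤ.+≤+ (ℕ.m≤m*n (suc ℤ.∣ a ∣) (suc d)) ⟩
    ℤ.+ (suc ℤ.∣ a ∣ ℕ.* suc d)      ≡⟨ ℤ.pos-* (suc ℤ.∣ a ∣) (suc d) ⟩
    ℤ.+ suc ℤ.∣ a ∣ ℤ.* ℤ.+ suc d      ∎))
    where
    open ℤ.≤-Reasoning
    i≤∣i∣ : ∀ i → i ℤ.≤ ℤ.+ ℤ.∣ i ∣
    i≤∣i∣ (ℤ.+ n)        = ℤ.≤-refl
    i≤∣i∣ ℤ.-[1+ n ]   = ℤ.-≤+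

  inv-small : ∀ ε → 0ℚ < ε → ∃ λ N → ∀ n → N ℕ.≤ n → inv n < ε
  inv-small ε 0<ε = N , λ n N≤n → begin-strict
    inv n                      ≡⟨ sym (*-identityˡ (inv n)) ⟩
    1ℚ * inv n                 <⟨ *-monoˡ-<-pos (inv n) {{subst Positive (sym (inv-mkℚ n)) _}} (1<ε*ι n N≤n) ⟩
    ε * ι (suc n) * inv n      ≡⟨ *-assoc ε (ι (suc n)) (inv n) ⟩
    ε * (ι (suc n) * inv n)    ≡⟨ cong (ε *_) (ι*inv n) ⟩
    ε * 1ℚ                     ≡⟨ *-identityʳ ε ⟩
    ε                          ∎
    where
    open ≤-Reasoning
    instance
      ε-nonZero : NonZero ε
      ε-nonZero = >-nonZero 0<ε
    N : ℕ
    N = proj₁ (archimedean (1/ ε))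
    1<ε*ι : ∀ n → N ℕ.≤ n → 1ℚ < ε * ι (suc n)
    1<ε*ι n N≤n = begin-strict
      1ℚ            ≡⟨ sym (*-inverseʳ ε) ⟩
      ε * 1/ ε      <⟨ *-monoʳ-<-pos ε {{positive 0<ε}} (<-≤-trans (proj₂ (archimedean (1/ ε))) (ι-mono (ℕ.≤-trans N≤n (ℕ.n≤1+n n)))) ⟩
      ε * ι (suc n) ∎

  shrink : ∀ C ε → 0ℚ ≤ C → 0ℚ < ε → ∃ λ δ → 0ℚ < δ × C * δ < ε
  shrink C ε 0≤C 0<ε = δ , 0<δ , (begin-strict
    C * δ            ≡⟨ sym (+-identityˡ _) ⟩
    0ℚ + C * δ       <⟨ +-monoˡ-< (C * δ) 0<δ ⟩
    δ + C * δ        ≡⟨ lem C ε (1/ D) ⟩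
    ε * (D * 1/ D)   ≡⟨ cong (ε *_) (*-inverseʳ D) ⟩
    ε * 1ℚ           ≡⟨ *-identityʳ ε ⟩
    ε                ∎)
    where
    open ≤-Reasoning
    D : ℚ
    D = 1ℚ + C
    0<D : 0ℚ < D
    0<D = +-pos-nonneg 0<1 0≤C
    instance
      D-nonZero : NonZero D
      D-nonZero = >-nonZero 0<D
    δ : ℚ
    δ = ε * 1/ D
    0<δ : 0ℚ < δ
    0<δ = *-pos 0<ε (positive⁻¹ _ {{1/pos⇒pos D {{positive 0<D}}}})
    lem : ∀ C ε r → ε * r + C * (ε * r) ≡ ε * ((1ℚ + C) * r)
    lem = solve-∀ ring

  shrink₃ : ∀ C ε → 0ℚ ≤ C → 0ℚ < ε → ∃ λ δ → 0ℚ < δ × C * δ + C * (δ + δ) < ε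
  shrink₃ C ε 0≤C 0<ε = proj₁ δ , proj₁ (proj₂ δ) , subst (_< ε) (lem C (proj₁ δ)) (proj₂ (proj₂ δ))
    where
    δ : ∃ λ δ → 0ℚ < δ × (C + (C + C)) * δ < ε
    δ = shrink (C + (C + C)) ε (+-nonneg 0≤C (+-nonneg 0≤C 0≤C)) 0<ε
    lem : ∀ C d → (C + (C + C)) * d ≡ C * d + C * (d + d)
    lem = solve-∀ ring

  halve : ∀ ε → 0ℚ < ε → ∃ λ δ → 0ℚ < δ × δ + δ < ε
  halve ε 0<ε = proj₁ δ , proj₁ (proj₂ δ) , subst (_< ε) (lem (proj₁ δ)) (proj₂ (proj₂ δ))
    where
    δ : ∃ λ δ → 0ℚ < δ × (1ℚ + 1ℚ) * δ < ε
    δ = shrink (1ℚ + 1ℚ) ε (+-nonneg 0≤1 0≤1) 0<ε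
    lem : ∀ d → (1ℚ + 1ℚ) * d ≡ d + d
    lem = solve-∀ ring

^-nonneg : ∀ {x} n → 0ℚ ≤ x → 0ℚ ≤ x ^ n
^-nonneg zero    h = 0≤1
^-nonneg (suc n) h = *-nonneg h (^-nonneg n h)

1≤^ : ∀ {x} n → 1ℚ ≤ x → 1ℚ ≤ x ^ n
1≤^ zero    h = ≤-refl
1≤^ {x} (suc n) h = subst (_≤ x * x ^ n) (*-identityˡ 1ℚ) (*-mono-≤ 0≤1 0≤1 h (1≤^ n h))

^-mono : ∀ {x y} n → 0ℚ ≤ x → x ≤ y → x ^ n ≤ y ^ n
^-mono zero    0≤x x≤y = ≤-refl
^-mono (suc n) 0≤x x≤y = *-mono-≤ 0≤x (^-nonneg n 0≤x) x≤y (^-mono n 0≤x x≤y)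

x≤x^1+n : ∀ {x} n → 1ℚ ≤ x → x ≤ x ^ suc n
x≤x^1+n {x} n h = subst (_≤ x * x ^ n) (*-identityʳ x)
  (*-mono-≤ (≤-trans 0≤1 h) 0≤1 ≤-refl (1≤^ n h))

∣^∣≤ : ∀ {x M} n → ∣ x ∣ ≤ M → ∣ x ^ n ∣ ≤ M ^ n
∣^∣≤ zero    h = ≤-refl
∣^∣≤ {x} {M} (suc n) h = subst (_≤ M * M ^ n) (sym (∣p*q∣≡∣p∣*∣q∣ x (x ^ n)))
  (*-mono-≤ (0≤∣p∣ x) (0≤∣p∣ (x ^ n)) h (∣^∣≤ n h))

bernoulli : ∀ t n → 0ℚ ≤ t → 1ℚ + ι n * t ≤ (1ℚ + t) ^ n
bernoulli t zero    h = ≤-reflexive (trans (cong (1ℚ +_) (*-zeroˡ t)) (+-identityʳ 1ℚ))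
bernoulli t (suc n) h = begin
  1ℚ + ι (suc n) * t                  ≡⟨ cong (λ k → 1ℚ + k * t) (ι-suc n) ⟩
  1ℚ + (1ℚ + ι n) * t                 ≤⟨ p≤p+q (*-nonneg (0≤ι n) (*-nonneg h h)) ⟩
  1ℚ + (1ℚ + ι n) * t + ι n * (t * t) ≡⟨ lem (ι n) t ⟩
  (1ℚ + t) * (1ℚ + ι n * t)           ≤⟨ *-monoˡ-≤-nonNeg (1ℚ + t) {{nonNegative (+-nonneg 0≤1 h)}} (bernoulli t n h) ⟩
  (1ℚ + t) * (1ℚ + t) ^ n             ∎
  where
  open ≤-Reasoning
  lem : ∀ k t → 1ℚ + (1ℚ + k) * t + k * (t * t) ≡ (1ℚ + t) * (1ℚ + k * t)
  lem = solve-∀ ring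

^-≤-linear : ∀ t n → 0ℚ ≤ t → ι n * (t + t) ≤ 1ℚ → (1ℚ + t) ^ n ≤ 1ℚ + ι n * (t + t)
^-≤-linear t zero    0≤t h = p≤p+q (*-nonneg (0≤ι 0) (+-nonneg 0≤t 0≤t))
^-≤-linear t (suc n) 0≤t h = begin
  (1ℚ + t) * (1ℚ + t) ^ n            ≤⟨ *-monoˡ-≤-nonNeg (1ℚ + t) {{nonNegative (+-nonneg 0≤1 0≤t)}} (^-≤-linear t n 0≤t h′) ⟩
  (1ℚ + t) * (1ℚ + a)                ≡⟨ lem₁ t a ⟩
  1ℚ + a + t + t * a                 ≤⟨ +-monoʳ-≤ (1ℚ + a + t) (*-monoˡ-≤-nonNeg t {{nonNegative 0≤t}} h′) ⟩
  1ℚ + a + t + t * 1ℚ                ≡⟨ lem₂ t (ι n) ⟩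
  1ℚ + (1ℚ + ι n) * (t + t)          ≡⟨ cong (λ k → 1ℚ + k * (t + t)) (sym (ι-suc n)) ⟩
  1ℚ + ι (suc n) * (t + t)           ∎
  where
  open ≤-Reasoning
  a = ι n * (t + t)
  h′ : a ≤ 1ℚ
  h′ = ≤-trans (*-monoʳ-≤-nonNeg (t + t) {{nonNegative (+-nonneg 0≤t 0≤t)}} (ι-mono (ℕ.n≤1+n n))) h
  lem₁ : ∀ t a → (1ℚ + t) * (1ℚ + a) ≡ 1ℚ + a + t + t * a
  lem₁ = solve-∀ ring
  lem₂ : ∀ t k → 1ℚ + k * (t + t) + t + t * 1ℚ ≡ 1ℚ + (1ℚ + k) * (t + t)
  lem₂ = solve-∀ ring

^-difference : ∀ {x y M} n → 1ℚ ≤ M → ∣ x ∣ ≤ M → ∣ y ∣ ≤ M →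
               ∣ x ^ n - y ^ n ∣ ≤ ι n * M ^ n * ∣ x - y ∣
^-difference {x} {y} {M} zero _ _ _ =
  *-nonneg (*-nonneg (0≤ι 0) 0≤1) (0≤∣p∣ (x - y))
^-difference {x} {y} {M} (suc n) 1≤M x≤M y≤M = begin
  ∣ x * x ^ n - y * y ^ n ∣                          ≡⟨ cong ∣_∣ (lem₁ x (x ^ n) y (y ^ n)) ⟩
  ∣ x * (x ^ n - y ^ n) + (x - y) * y ^ n ∣          ≤⟨ ∣p+q∣≤∣p∣+∣q∣ (x * (x ^ n - y ^ n)) ((x - y) * y ^ n) ⟩
  ∣ x * (x ^ n - y ^ n) ∣ + ∣ (x - y) * y ^ n ∣      ≡⟨ cong₂ _+_ (∣p*q∣≡∣p∣*∣q∣ x _) (∣p*q∣≡∣p∣*∣q∣ (x - y) _) ⟩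
  ∣ x ∣ * ∣ x ^ n - y ^ n ∣ + d * ∣ y ^ n ∣          ≤⟨ +-mono-≤
                                                          (*-mono-≤ (0≤∣p∣ x) (0≤∣p∣ _) x≤M (^-difference n 1≤M x≤M y≤M))
                                                          (*-monoˡ-≤-nonNeg d {{nonNegative 0≤d}} y^n≤) ⟩
  M * (ι n * M ^ n * d) + d * (M * M ^ n)            ≡⟨ lem₂ M (ι n) (M ^ n) d ⟩
  (1ℚ + ι n) * (M * M ^ n) * d                       ≡⟨ cong (λ k → k * (M * M ^ n) * d) (sym (ι-suc n)) ⟩
  ι (suc n) * (M * M ^ n) * d                        ∎
  where
  open ≤-Reasoning
  d = ∣ x - y ∣
  0≤d : 0ℚ ≤ d
  0≤d = 0≤∣p∣ (x - y)
  0≤M^n : 0ℚ ≤ M ^ n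
  0≤M^n = ^-nonneg n (≤-trans 0≤1 1≤M)
  y^n≤ : ∣ y ^ n ∣ ≤ M * M ^ n
  y^n≤ = ≤-trans (∣^∣≤ n y≤M)
    (subst (_≤ M * M ^ n) (*-identityˡ (M ^ n)) (*-monoʳ-≤-nonNeg (M ^ n) {{nonNegative 0≤M^n}} 1≤M))
  lem₁ : ∀ x a y b → x * a - y * b ≡ x * (a - b) + (x - y) * b
  lem₁ = solve-∀ ring
  lem₂ : ∀ M k p d → M * (k * p * d) + d * (M * p) ≡ (1ℚ + k) * (M * p) * d
  lem₂ = solve-∀ ring

^-second-order : ∀ t n → ∣ (1ℚ + t) ^ n - (1ℚ + ι n * t) ∣
                       ≤ (ι n * ∣ t ∣) * (ι n * ∣ t ∣) * (1ℚ + ∣ t ∣) ^ n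
^-second-order t zero = ≤-trans (≤-reflexive (cong ∣_∣ (lem t)))
    (*-nonneg (*-nonneg h h) 0≤1)
  where
  h : 0ℚ ≤ ι 0 * ∣ t ∣
  h = *-nonneg (0≤ι 0) (0≤∣p∣ t)
  lem : ∀ t → 1ℚ - (1ℚ + 0ℚ * t) ≡ 0ℚ
  lem = solve-∀ ring
^-second-order t (suc n) = begin
  ∣ (1ℚ + t) * P - (1ℚ + ι (suc n) * t) ∣    ≡⟨ cong (λ k → ∣ (1ℚ + t) * P - (1ℚ + k * t) ∣) (ι-suc n) ⟩
  ∣ (1ℚ + t) * P - (1ℚ + (1ℚ + k) * t) ∣     ≡⟨ cong ∣_∣ (lem₁ t P k) ⟩
  ∣ (1ℚ + t) * e + k * (t * t) ∣             ≤⟨ ∣p+q∣≤∣p∣+∣q∣ ((1ℚ + t) * e) (k * (t * t)) ⟩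
  ∣ (1ℚ + t) * e ∣ + ∣ k * (t * t) ∣         ≡⟨ cong₂ _+_ (∣p*q∣≡∣p∣*∣q∣ (1ℚ + t) e)
                                                 (trans (∣p*q∣≡∣p∣*∣q∣ k (t * t)) (cong₂ _*_ (0≤p⇒∣p∣≡p (0≤ι n)) (∣p*q∣≡∣p∣*∣q∣ t t))) ⟩
  ∣ 1ℚ + t ∣ * ∣ e ∣ + k * (s * s)           ≤⟨ +-monoˡ-≤ (k * (s * s))
                                                 (*-mono-≤ (0≤∣p∣ (1ℚ + t)) (0≤∣p∣ e) (∣p+q∣≤∣p∣+∣q∣ 1ℚ t) (^-second-order t n)) ⟩
  Q * ((k * s) * (k * s) * q) + k * (s * s)  ≤⟨ +-monoʳ-≤ (Q * ((k * s) * (k * s) * q)) tail≤ ⟩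
  Q * ((k * s) * (k * s) * q) + (k * (s * s) * (Q * q) + ((k + 1ℚ) * (s * s) * (Q * q)))
                                             ≡⟨ lem₂ k s Q q ⟩
  ((1ℚ + k) * s) * ((1ℚ + k) * s) * (Q * q)  ≡⟨ cong (λ k → (k * s) * (k * s) * (Q * q)) (sym (ι-suc n)) ⟩
  (ι (suc n) * s) * (ι (suc n) * s) * (Q * q) ∎
  where
  open ≤-Reasoning
  k = ι n
  s = ∣ t ∣
  P = (1ℚ + t) ^ n
  Q = 1ℚ + s
  q = Q ^ n
  e = P - (1ℚ + k * t)
  0≤s² : 0ℚ ≤ s * s
  0≤s² = *-nonneg (0≤∣p∣ t) (0≤∣p∣ t)
  1≤Q : 1ℚ ≤ Q
  1≤Q = p≤p+q (0≤∣p∣ t)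
  0≤Qq : 0ℚ ≤ Q * q
  0≤Qq = ^-nonneg (suc n) (≤-trans 0≤1 1≤Q)
  tail≤ : k * (s * s) ≤ k * (s * s) * (Q * q) + ((k + 1ℚ) * (s * s) * (Q * q))
  tail≤ = ≤-trans
    (subst (_≤ k * (s * s) * (Q * q)) (*-identityʳ (k * (s * s)))
      (*-monoˡ-≤-nonNeg (k * (s * s)) {{nonNegative (*-nonneg (0≤ι n) 0≤s²)}} (1≤^ (suc n) 1≤Q)))
    (p≤p+q (*-nonneg (*-nonneg (+-nonneg (0≤ι n) 0≤1) 0≤s²) 0≤Qq))
  lem₁ : ∀ t P k → (1ℚ + t) * P - (1ℚ + (1ℚ + k) * t) ≡ (1ℚ + t) * (P - (1ℚ + k * t)) + k * (t * t)
  lem₁ = solve-∀ ring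
  lem₂ : ∀ k s Q q → Q * ((k * s) * (k * s) * q) + (k * (s * s) * (Q * q) + ((k + 1ℚ) * (s * s) * (Q * q)))
                   ≡ ((1ℚ + k) * s) * ((1ℚ + k) * s) * (Q * q)
  lem₂ = solve-∀ ring

∑<-const : ∀ n b → ∑< n (λ _ → b) ≡ ι n * b
∑<-const zero    b = sym (*-zeroˡ b)
∑<-const (suc n) b = begin
  b + ∑< n (λ _ → b)  ≡⟨ cong (λ s → b + s) (∑<-const n b) ⟩
  b + ι n * b         ≡⟨ lem (ι n) b ⟩
  (1ℚ + ι n) * b      ≡⟨ cong (_* b) (sym (ι-suc n)) ⟩
  ι (suc n) * b       ∎
  where
  open ≡-Reasoning
  lem : ∀ k b → b + k * b ≡ (1ℚ + k) * b
  lem = solve-∀ ring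

∑<-cong : ∀ n {f g : ℕ → ℚ} → (∀ i → f i ≡ g i) → ∑< n f ≡ ∑< n g
∑<-cong zero    h = refl
∑<-cong (suc n) h = cong₂ _+_ (h 0) (∑<-cong n (λ i → h (suc i)))

∑<-difference : ∀ n (f g : ℕ → ℚ) b → (∀ i → i ℕ.< n → ∣ f i - g i ∣ ≤ b) →
                ∣ ∑< n f - ∑< n g ∣ ≤ ι n * b
∑<-difference zero    f g b h = ≤-reflexive (sym (*-zeroˡ b))
∑<-difference (suc n) f g b h = begin
  ∣ (f 0 + F) - (g 0 + G) ∣       ≡⟨ cong ∣_∣ (lem₁ (f 0) F (g 0) G) ⟩
  ∣ (f 0 - g 0) + (F - G) ∣       ≤⟨ ∣p+q∣≤∣p∣+∣q∣ (f 0 - g 0) (F - G) ⟩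
  ∣ f 0 - g 0 ∣ + ∣ F - G ∣       ≤⟨ +-mono-≤ (h 0 (ℕ.s≤s ℕ.z≤n))
                                       (∑<-difference n (λ i → f (suc i)) (λ i → g (suc i)) b (λ i i<n → h (suc i) (ℕ.s≤s i<n))) ⟩
  b + ι n * b                     ≡⟨ lem₂ (ι n) b ⟩
  (1ℚ + ι n) * b                  ≡⟨ cong (_* b) (sym (ι-suc n)) ⟩
  ι (suc n) * b                   ∎
  where
  open ≤-Reasoning
  F = ∑< n (λ i → f (suc i))
  G = ∑< n (λ i → g (suc i))
  lem₁ : ∀ a b c d → (a + b) - (c + d) ≡ (a - c) + (b - d)
  lem₁ = solve-∀ ring
  lem₂ : ∀ k b → b + k * b ≡ (1ℚ + k) * b
  lem₂ = solve-∀ ring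

∑<-+ : ∀ m n (f : ℕ → ℚ) → ∑< (m ℕ.+ n) f ≡ ∑< m f + ∑< n (λ j → f (m ℕ.+ j))
∑<-+ zero    n f = sym (+-identityˡ _)
∑<-+ (suc m) n f = trans (cong (λ s → f 0 + s) (∑<-+ m n (λ i → f (suc i)))) (sym (+-assoc (f 0) _ _))

∑<-* : ∀ m n (f : ℕ → ℚ) → ∑< (m ℕ.* n) f ≡ ∑< m (λ i → ∑< n (λ j → f (i ℕ.* n ℕ.+ j)))
∑<-* zero    n f = refl
∑<-* (suc m) n f = trans (∑<-+ n (m ℕ.* n) f) (cong (λ s → ∑< n f + s)
  (trans (∑<-* m n (λ j → f (n ℕ.+ j)))
    (∑<-cong m (λ i → ∑<-cong n (λ j → cong f (sym (ℕ.+-assoc n (i ℕ.* n) j)))))))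

------------------------------------------------------------------------
-- Real numbers: Cauchy sequences of rationals (with a modulus), compared
-- by the setoid equality _≈ᴿ_

Eventually : (ℕ → Set) → Set
Eventually P = ∃ λ N → ∀ n → N ℕ.≤ n → P n

IsCauchy : (ℕ → ℚ) → Set
IsCauchy x = ∀ ε → 0ℚ < ε → ∃ λ N → ∀ m n → N ℕ.≤ m → N ℕ.≤ n → ∣ x m - x n ∣ < ε

record ℝ : Set where
  constructor mkℝ
  field
    seq    : ℕ → ℚ
    cauchy : IsCauchy seq

open ℝ public

infix 4 _≈ᴿ_ _<ᴿ_ _≤ᴿ_

_≈ᴿ_ : ℝ → ℝ → Set
x ≈ᴿ y = ∀ ε → 0ℚ < ε → Eventually λ n → ∣ seq x n - seq y n ∣ < ε

_<ᴿ_ : ℝ → ℝ → Set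
x <ᴿ y = ∃ λ ε → 0ℚ < ε × Eventually λ n → seq x n + ε < seq y n

_≤ᴿ_ : ℝ → ℝ → Set
x ≤ᴿ y = ∀ ε → 0ℚ < ε → Eventually λ n → seq x n < seq y n + ε

abstract
  eventually-× : ∀ {P Q} → Eventually P → Eventually Q → Eventually λ n → P n × Q n
  eventually-× (M , p) (N , q) = M ℕ.⊔ N , λ n h →
    p n (ℕ.≤-trans (ℕ.m≤m⊔n M N) h) , q n (ℕ.≤-trans (ℕ.m≤n⊔m M N) h)

  eventually-bounded : ∀ x → ∃ λ K → 0ℚ ≤ K × Eventually λ n → ∣ seq x n ∣ ≤ K
  eventually-bounded x with cauchy x 1ℚ 0<1
  ... | N , h = ∣ seq x N ∣ + 1ℚ , +-nonneg (0≤∣p∣ (seq x N)) 0≤1 , N , λ n N≤n → begin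
    ∣ seq x n ∣                          ≡⟨ cong ∣_∣ (lem (seq x n) (seq x N)) ⟩
    ∣ seq x N + (seq x n - seq x N) ∣    ≤⟨ ∣p+q∣≤∣p∣+∣q∣ (seq x N) (seq x n - seq x N) ⟩
    ∣ seq x N ∣ + ∣ seq x n - seq x N ∣  ≤⟨ +-monoʳ-≤ ∣ seq x N ∣ (<⇒≤ (h n N N≤n ℕ.≤-refl)) ⟩
    ∣ seq x N ∣ + 1ℚ                     ∎
    where
    open ≤-Reasoning
    lem : ∀ a b → a ≡ b + (a - b)
    lem = solve-∀ ring

const-cauchy : ∀ q → IsCauchy (λ _ → q)
const-cauchy q ε 0<ε = 0 , λ _ _ _ _ → subst (_< ε) (sym (cong ∣_∣ (+-inverseʳ q))) 0<ε

+-cauchy : ∀ x y → IsCauchy (λ n → seq x n + seq y n)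
+-cauchy x y ε 0<ε with halve ε 0<ε
... | δ , 0<δ , 2δ<ε with cauchy x δ 0<δ | cauchy y δ 0<δ
... | M , p | N , q = M ℕ.⊔ N , λ m n hm hn → begin-strict
  ∣ (seq x m + seq y m) - (seq x n + seq y n) ∣     ≡⟨ cong ∣_∣ (lem₁ (seq x m) (seq y m) (seq x n) (seq y n)) ⟩
  ∣ (seq x m - seq x n) + (seq y m - seq y n) ∣     ≤⟨ ∣p+q∣≤∣p∣+∣q∣ (seq x m - seq x n) (seq y m - seq y n) ⟩
  ∣ seq x m - seq x n ∣ + ∣ seq y m - seq y n ∣     <⟨ +-mono-<
      (p m n (ℕ.≤-trans (ℕ.m≤m⊔n M N) hm) (ℕ.≤-trans (ℕ.m≤m⊔n M N) hn))
      (q m n (ℕ.≤-trans (ℕ.m≤n⊔m M N) hm) (ℕ.≤-trans (ℕ.m≤n⊔m M N) hn)) ⟩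
  δ + δ                                             <⟨ 2δ<ε ⟩
  ε                                                 ∎
  where
  open ≤-Reasoning
  lem₁ : ∀ a b c d → (a + b) - (c + d) ≡ (a - c) + (b - d)
  lem₁ = solve-∀ ring

neg-cauchy : ∀ x → IsCauchy (λ n → - seq x n)
neg-cauchy x ε 0<ε with cauchy x ε 0<ε
... | N , p = N , λ m n hm hn → subst (_< ε)
    (trans (∣p-q∣≡∣q-p∣ (seq x m) (seq x n)) (cong ∣_∣ (lem (seq x m) (seq x n)))) (p m n hm hn)
  where
  lem : ∀ a b → b - a ≡ - a - (- b)
  lem = solve-∀ ring

*-difference : ∀ {K L a b c d} → ∣ a ∣ ≤ K → ∣ d ∣ ≤ L →
               ∣ a * b - c * d ∣ ≤ K * ∣ b - d ∣ + L * ∣ a - c ∣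
*-difference {K} {L} {a} {b} {c} {d} ha hd = begin
  ∣ a * b - c * d ∣                      ≡⟨ cong ∣_∣ (lem a b c d) ⟩
  ∣ a * (b - d) + d * (a - c) ∣          ≤⟨ ∣p+q∣≤∣p∣+∣q∣ (a * (b - d)) (d * (a - c)) ⟩
  ∣ a * (b - d) ∣ + ∣ d * (a - c) ∣      ≡⟨ cong₂ _+_ (∣p*q∣≡∣p∣*∣q∣ a (b - d)) (∣p*q∣≡∣p∣*∣q∣ d (a - c)) ⟩
  ∣ a ∣ * ∣ b - d ∣ + ∣ d ∣ * ∣ a - c ∣  ≤⟨ +-mono-≤ (*-monoʳ-≤-nonNeg _ {{∣-∣-nonNeg (b - d)}} ha) (*-monoʳ-≤-nonNeg _ {{∣-∣-nonNeg (a - c)}} hd) ⟩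
  K * ∣ b - d ∣ + L * ∣ a - c ∣          ∎
  where
  open ≤-Reasoning
  lem : ∀ a b c d → a * b - c * d ≡ a * (b - d) + d * (a - c)
  lem = solve-∀ ring

*-difference-< : ∀ {K L a b c d δ ε} → 0ℚ ≤ K → 0ℚ ≤ L → (K + L) * δ < ε →
                 ∣ a ∣ ≤ K → ∣ d ∣ ≤ L → ∣ a - c ∣ < δ → ∣ b - d ∣ < δ →
                 ∣ a * b - c * d ∣ < ε
*-difference-< {K} {L} {a} {b} {c} {d} {δ} {ε} 0≤K 0≤L Cδ<ε ha hd hac hbd = begin-strict
  ∣ a * b - c * d ∣              ≤⟨ *-difference ha hd ⟩
  K * ∣ b - d ∣ + L * ∣ a - c ∣  ≤⟨ +-mono-≤ (*-monoˡ-≤-nonNeg K {{nonNegative 0≤K}} (<⇒≤ hbd)) (*-monoˡ-≤-nonNeg L {{nonNegative 0≤L}} (<⇒≤ hac)) ⟩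
  K * δ + L * δ                  ≡⟨ sym (*-distribʳ-+ δ K L) ⟩
  (K + L) * δ                    <⟨ Cδ<ε ⟩
  ε                              ∎ where open ≤-Reasoning

*-cauchy : ∀ x y → IsCauchy (λ n → seq x n * seq y n)
*-cauchy x y ε 0<ε with eventually-bounded x | eventually-bounded y
... | K , 0≤K , A , a | L , 0≤L , B , b with shrink (K + L) ε (+-nonneg 0≤K 0≤L) 0<ε
... | δ , 0<δ , Cδ<ε with cauchy x δ 0<δ | cauchy y δ 0<δ
... | M , p | N , q = (A ℕ.⊔ B) ℕ.⊔ (M ℕ.⊔ N) , λ m n hm hn →
  *-difference-< 0≤K 0≤L Cδ<ε
    (a m (ℕ.≤-trans (ℕ.m≤m⊔n A B) (ℕ.m⊔n≤o⇒m≤o (A ℕ.⊔ B) (M ℕ.⊔ N) hm)))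
    (b n (ℕ.≤-trans (ℕ.m≤n⊔m A B) (ℕ.m⊔n≤o⇒m≤o (A ℕ.⊔ B) (M ℕ.⊔ N) hn)))
    (p m n (ℕ.≤-trans (ℕ.m≤m⊔n M N) (ℕ.m⊔n≤o⇒n≤o (A ℕ.⊔ B) (M ℕ.⊔ N) hm))
           (ℕ.≤-trans (ℕ.m≤m⊔n M N) (ℕ.m⊔n≤o⇒n≤o (A ℕ.⊔ B) (M ℕ.⊔ N) hn)))
    (q m n (ℕ.≤-trans (ℕ.m≤n⊔m M N) (ℕ.m⊔n≤o⇒n≤o (A ℕ.⊔ B) (M ℕ.⊔ N) hm))
           (ℕ.≤-trans (ℕ.m≤n⊔m M N) (ℕ.m⊔n≤o⇒n≤o (A ℕ.⊔ B) (M ℕ.⊔ N) hn)))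

infixl 6 _+ᴿ_ _-ᴿ_
infixl 7 _*ᴿ_

fromℕ : ℕ → ℝ
fromℕ k = mkℝ (λ _ → ι k) (const-cauchy (ι k))

0ᴿ 1ᴿ : ℝ
0ᴿ = fromℕ 0
1ᴿ = fromℕ 1

_+ᴿ_ _-ᴿ_ _*ᴿ_ : ℝ → ℝ → ℝ
x +ᴿ y = mkℝ (λ n → seq x n + seq y n) (+-cauchy x y)
x -ᴿ y = x +ᴿ mkℝ (λ n → - seq y n) (neg-cauchy y)
x *ᴿ y = mkℝ (λ n → seq x n * seq y n) (*-cauchy x y)

≈ᴿ-refl : ∀ {x} → x ≈ᴿ x
≈ᴿ-refl {x} ε 0<ε = 0 , λ n _ → subst (_< ε) (sym (cong ∣_∣ (+-inverseʳ (seq x n)))) 0<ε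

*ᴿ-cong : ∀ {x x′ y y′} → x ≈ᴿ x′ → y ≈ᴿ y′ → x *ᴿ y ≈ᴿ x′ *ᴿ y′
*ᴿ-cong {x} {x′} {y} {y′} hx hy ε 0<ε with eventually-bounded x | eventually-bounded y′
... | K , 0≤K , a | L , 0≤L , b with shrink (K + L) ε (+-nonneg 0≤K 0≤L) 0<ε
... | δ , 0<δ , Cδ<ε with eventually-× (eventually-× a b) (eventually-× (hx δ 0<δ) (hy δ 0<δ))
... | N , h = N , λ n N≤n → let ((p , q) , (r , s)) = h n N≤n in
  *-difference-< 0≤K 0≤L Cδ<ε p q r s

≤ᴿ-respʳ : ∀ {x y z} → y ≈ᴿ z → x ≤ᴿ y → x ≤ᴿ z
≤ᴿ-respʳ {x} {y} {z} y≈z x≤y ε 0<ε with halve ε 0<ε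
... | δ , 0<δ , 2δ<ε with eventually-× (y≈z δ 0<δ) (x≤y δ 0<δ)
... | N , h = N , λ n N≤n → let (d<δ , x<) = h n N≤n in begin-strict
  seq x n                                      <⟨ x< ⟩
  seq y n + δ                                  ≡⟨ cong (_+ δ) (lem₁ (seq y n) (seq z n)) ⟩
  seq z n + (seq y n - seq z n) + δ            ≤⟨ +-monoˡ-≤ δ (+-monoʳ-≤ (seq z n) (≤-trans (p≤∣p∣ (seq y n - seq z n)) (<⇒≤ d<δ))) ⟩
  seq z n + δ + δ                              ≡⟨ +-assoc (seq z n) δ δ ⟩
  seq z n + (δ + δ)                            <⟨ +-monoʳ-< (seq z n) 2δ<ε ⟩
  seq z n + ε                                  ∎
  where
  open ≤-Reasoning
  lem₁ : ∀ a b → a ≡ b + (a - b)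
  lem₁ = solve-∀ ring

-ᴿ-congˡ : ∀ {x y} z → x ≈ᴿ y → x -ᴿ z ≈ᴿ y -ᴿ z
-ᴿ-congˡ {x} {y} z h ε 0<ε with h ε 0<ε
... | N , p = N , λ n N≤n → subst (_< ε) (cong ∣_∣ (lem (seq x n) (seq y n) (seq z n))) (p n N≤n)
  where
  lem : ∀ a b c → a - b ≡ (a - c) - (b - c)
  lem = solve-∀ ring

------------------------------------------------------------------------
-- Functions ℝ → ℝ given by F x = lim F n (x n): enough that the F n are
-- Lipschitz and uniformly Cauchy on each interval [-K, K]

record Converges (F : ℕ → ℚ → ℚ) (K : ℚ) : Set where
  field
    bound     : ℚ
    0≤bound   : 0ℚ ≤ bound
    lipschitz : ∀ n x y → ∣ x ∣ ≤ K → ∣ y ∣ ≤ K → ∣ F n x - F n y ∣ ≤ bound * ∣ x - y ∣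
    uniform   : ∀ m n x → ∣ x ∣ ≤ K → ∣ F m x - F n x ∣ ≤ bound * (inv m + inv n)

ConvergesLocally : (ℕ → ℚ → ℚ) → Set
ConvergesLocally F = ∀ K → 0ℚ ≤ K → Converges F K

limit-cauchy : ∀ {F} → ConvergesLocally F → ∀ x → IsCauchy (λ n → F n (seq x n))
limit-cauchy {F} conv x ε 0<ε with eventually-bounded x
... | K , 0≤K , A , a with conv K 0≤K
... | record { bound = C ; 0≤bound = 0≤C ; lipschitz = lip ; uniform = uni }
  with shrink₃ C ε 0≤C 0<ε
... | δ , 0<δ , 3Cδ<ε with cauchy x δ 0<δ | inv-small δ 0<δ
... | M , p | N , q = A ℕ.⊔ (M ℕ.⊔ N) , λ m n hm hn →
  let A≤m = ℕ.m⊔n≤o⇒m≤o A (M ℕ.⊔ N) hm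
      A≤n = ℕ.m⊔n≤o⇒m≤o A (M ℕ.⊔ N) hn
      MN≤m = ℕ.m⊔n≤o⇒n≤o A (M ℕ.⊔ N) hm
      MN≤n = ℕ.m⊔n≤o⇒n≤o A (M ℕ.⊔ N) hn
      u = seq x m
      v = seq x n
  in begin-strict
  ∣ F m u - F n v ∣                              ≤⟨ ∣p-r∣≤∣p-q∣+∣q-r∣ (F m u) (F m v) (F n v) ⟩
  ∣ F m u - F m v ∣ + ∣ F m v - F n v ∣          ≤⟨ +-mono-≤ (lip m u v (a m A≤m) (a n A≤n)) (uni m n v (a n A≤n)) ⟩
  C * ∣ u - v ∣ + C * (inv m + inv n)            ≤⟨ +-mono-≤
      (*-monoˡ-≤-nonNeg C {{nonNegative 0≤C}} (<⇒≤ (p m n (ℕ.m⊔n≤o⇒m≤o M N MN≤m) (ℕ.m⊔n≤o⇒m≤o M N MN≤n))))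
      (*-monoˡ-≤-nonNeg C {{nonNegative 0≤C}} (+-mono-≤
        (<⇒≤ (q m (ℕ.m⊔n≤o⇒n≤o M N MN≤m))) (<⇒≤ (q n (ℕ.m⊔n≤o⇒n≤o M N MN≤n))))) ⟩
  C * δ + C * (δ + δ)                            <⟨ 3Cδ<ε ⟩
  ε                                              ∎
  where
  open ≤-Reasoning

limit : ∀ {F} → ConvergesLocally F → ℝ → ℝ
limit {F} conv x = mkℝ (λ n → F n (seq x n)) (limit-cauchy conv x)

limit-cong : ∀ {F} (conv : ConvergesLocally F) {x y} → x ≈ᴿ y → limit conv x ≈ᴿ limit conv y
limit-cong {F} conv {x} {y} h ε 0<ε with eventually-bounded x | eventually-bounded y
... | K , 0≤K , a | L , 0≤L , b with conv (K + L) (+-nonneg 0≤K 0≤L)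
... | record { bound = C ; 0≤bound = 0≤C ; lipschitz = lip } with shrink C ε 0≤C 0<ε
... | δ , 0<δ , Cδ<ε with eventually-× (eventually-× a b) (h δ 0<δ)
... | N , p = N , λ n N≤n → let ((x≤K , y≤L) , d<δ) = p n N≤n in begin-strict
  ∣ F n (seq x n) - F n (seq y n) ∣    ≤⟨ lip n (seq x n) (seq y n) (≤-trans x≤K (p≤p+q 0≤L)) (≤-trans y≤L (p≤q+p 0≤K)) ⟩
  C * ∣ seq x n - seq y n ∣            ≤⟨ *-monoˡ-≤-nonNeg C {{nonNegative 0≤C}} (<⇒≤ d<δ) ⟩
  C * δ                                <⟨ Cδ<ε ⟩
  ε                                    ∎
  where open ≤-Reasoning

via-common-refinement :
  ∀ (F : ℕ → ℚ → ℚ) C x →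
  (∀ m n → ∣ F m x - F (n ℕ.+ m ℕ.* suc n) x ∣ ≤ C * inv m) →
  ∀ m n → ∣ F m x - F n x ∣ ≤ C * (inv m + inv n)
via-common-refinement F C x h m n = begin
  ∣ F m x - F n x ∣                          ≤⟨ ∣p-r∣≤∣p-q∣+∣q-r∣ (F m x) (F k x) (F n x) ⟩
  ∣ F m x - F k x ∣ + ∣ F k x - F n x ∣      ≡⟨ cong (λ s → ∣ F m x - F k x ∣ + s) (∣p-q∣≡∣q-p∣ (F k x) (F n x)) ⟩
  ∣ F m x - F k x ∣ + ∣ F n x - F k x ∣      ≡⟨ cong (λ j → ∣ F m x - F k x ∣ + ∣ F n x - F j x ∣) (ℕ.suc-injective (ℕ.*-comm (suc m) (suc n))) ⟩
  ∣ F m x - F k x ∣ + ∣ F n x - F k′ x ∣     ≤⟨ +-mono-≤ (h m n) (h n m) ⟩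
  C * inv m + C * inv n                      ≡⟨ sym (*-distribˡ-+ C (inv m) (inv n)) ⟩
  C * (inv m + inv n)                        ∎
  where
  open ≤-Reasoning
  k = n ℕ.+ m ℕ.* suc n
  k′ = m ℕ.+ n ℕ.* suc m

------------------------------------------------------------------------
-- exp x = lim (1 + x / (n + 1)) ^ (n + 1)

expApprox : ℕ → ℚ → ℚ
expApprox n x = (1ℚ + x * inv n) ^ suc n

abstract
  expApprox-bound : ∀ K → ∃ λ C → ∀ n → 0ℚ ≤ K → (1ℚ + K * inv n) ^ suc n ≤ C
  expApprox-bound K with archimedean (K + K)
  ... | P , 2K<P = (1ℚ + 1ℚ) ^ P , λ n 0≤K → let t = ½ * inv n in begin
    (1ℚ + K * inv n) ^ suc n          ≤⟨ ^-mono (suc n) (+-nonneg 0≤1 (*-nonneg 0≤K (0≤inv n))) (base n 0≤K) ⟩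
    ((1ℚ + t) ^ P) ^ suc n            ≡⟨ ^-assocʳ (1ℚ + t) P (suc n) ⟩
    (1ℚ + t) ^ (P ℕ.* suc n)          ≡⟨ cong ((1ℚ + t) ^_) (ℕ.*-comm P (suc n)) ⟩
    (1ℚ + t) ^ (suc n ℕ.* P)          ≡⟨ sym (^-assocʳ (1ℚ + t) (suc n) P) ⟩
    ((1ℚ + t) ^ suc n) ^ P            ≤⟨ ^-mono P (^-nonneg (suc n) (+-nonneg 0≤1 (0≤t n)))
                                           (subst (λ s → (1ℚ + t) ^ suc n ≤ 1ℚ + s) (eq n) (^-≤-linear t (suc n) (0≤t n) (≤-reflexive (eq n)))) ⟩
    (1ℚ + 1ℚ) ^ P                     ∎
    where
    open ≤-Reasoning
    0≤½ : 0ℚ ≤ ½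
    0≤½ = nonNegative⁻¹ ½
    0≤t : ∀ n → 0ℚ ≤ ½ * inv n
    0≤t n = *-nonneg 0≤½ (0≤inv n)
    lem₁ : ∀ a h → a * (½ * h + ½ * h) ≡ a * h
    lem₁ a h = cong (a *_) (trans (sym (*-distribʳ-+ h ½ ½)) (*-identityˡ h))
    eq : ∀ n → ι (suc n) * (½ * inv n + ½ * inv n) ≡ 1ℚ
    eq n = trans (lem₁ (ι (suc n)) (inv n)) (ι*inv n)
    lem₂ : ∀ K h → K * h ≡ (K + K) * (½ * h)
    lem₂ K h = trans (cong (K *_) (trans (sym (*-identityˡ h)) (*-distribʳ-+ h ½ ½))) (lem₃ K (½ * h))
      where
      lem₃ : ∀ K g → K * (g + g) ≡ (K + K) * g
      lem₃ = solve-∀ ring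
    base : ∀ n → 0ℚ ≤ K → 1ℚ + K * inv n ≤ (1ℚ + ½ * inv n) ^ P
    base n 0≤K = begin
      1ℚ + K * inv n                ≡⟨ cong (λ s → 1ℚ + s) (lem₂ K (inv n)) ⟩
      1ℚ + (K + K) * (½ * inv n)    ≤⟨ +-monoʳ-≤ 1ℚ (*-monoʳ-≤-nonNeg (½ * inv n) {{nonNegative (0≤t n)}} (<⇒≤ 2K<P)) ⟩
      1ℚ + ι P * (½ * inv n)        ≤⟨ bernoulli (½ * inv n) P (0≤t n) ⟩
      (1ℚ + ½ * inv n) ^ P          ∎

∣1+x*h∣≤ : ∀ {x K h} → 0ℚ ≤ h → ∣ x ∣ ≤ K → ∣ 1ℚ + x * h ∣ ≤ 1ℚ + K * h
∣1+x*h∣≤ {x} {K} {h} 0≤h x≤K = ≤-trans (∣p+q∣≤∣p∣+∣q∣ 1ℚ (x * h))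
  (+-monoʳ-≤ 1ℚ (subst (_≤ K * h)
    (sym (trans (∣p*q∣≡∣p∣*∣q∣ x h) (cong (∣ x ∣ *_) (0≤p⇒∣p∣≡p 0≤h))))
    (*-monoʳ-≤-nonNeg h {{nonNegative 0≤h}} x≤K)))

expApprox-lipschitz : ∀ {K C} → 0ℚ ≤ K → (∀ n → (1ℚ + K * inv n) ^ suc n ≤ C) →
  ∀ n x y → ∣ x ∣ ≤ K → ∣ y ∣ ≤ K → ∣ expApprox n x - expApprox n y ∣ ≤ C * ∣ x - y ∣
expApprox-lipschitz {K} {C} 0≤K hC n x y hx hy = begin
  ∣ (1ℚ + x * h) ^ N - (1ℚ + y * h) ^ N ∣           ≤⟨ ^-difference N (p≤p+q (*-nonneg 0≤K (0≤inv n))) (∣1+x*h∣≤ (0≤inv n) hx) (∣1+x*h∣≤ (0≤inv n) hy) ⟩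
  ι N * M ^ N * ∣ (1ℚ + x * h) - (1ℚ + y * h) ∣     ≡⟨ cong (λ s → ι N * M ^ N * s) d≡ ⟩
  ι N * M ^ N * (∣ x - y ∣ * h)                     ≡⟨ lem₂ (ι N) (M ^ N) ∣ x - y ∣ h ⟩
  (ι N * h) * (M ^ N * ∣ x - y ∣)                   ≡⟨ trans (cong (_* (M ^ N * ∣ x - y ∣)) (ι*inv n)) (*-identityˡ _) ⟩
  M ^ N * ∣ x - y ∣                                 ≤⟨ *-monoʳ-≤-nonNeg ∣ x - y ∣ {{∣-∣-nonNeg (x - y)}} (hC n) ⟩
  C * ∣ x - y ∣                                     ∎
  where
  open ≤-Reasoning
  h = inv n
  N = suc n
  M = 1ℚ + K * h
  lem₁ : ∀ x y h → (1ℚ + x * h) - (1ℚ + y * h) ≡ (x - y) * h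
  lem₁ = solve-∀ ring
  d≡ : ∣ (1ℚ + x * h) - (1ℚ + y * h) ∣ ≡ ∣ x - y ∣ * h
  d≡ = trans (cong ∣_∣ (lem₁ x y h)) (trans (∣p*q∣≡∣p∣*∣q∣ (x - y) h) (cong (∣ x - y ∣ *_) (0≤p⇒∣p∣≡p (0≤inv n))))
  lem₂ : ∀ a b c d → a * b * (c * d) ≡ (a * d) * (b * c)
  lem₂ = solve-∀ ring

expApprox-refine : ∀ {K C x} → 0ℚ ≤ K → (∀ n → (1ℚ + K * inv n) ^ suc n ≤ C) → ∣ x ∣ ≤ K →
  ∀ m n → ∣ expApprox m x - expApprox (n ℕ.+ m ℕ.* suc n) x ∣ ≤ C * (K * K * C) * inv m
expApprox-refine {K} {C} {x} 0≤K hC hx m n = begin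
  ∣ expApprox m x - expApprox k x ∣            ≡⟨ ∣p-q∣≡∣q-p∣ (expApprox m x) (expApprox k x) ⟩
  ∣ expApprox k x - expApprox m x ∣            ≡⟨ cong₂ (λ s r → ∣ s - r ^ M ∣) A^M≡ (sym B≡) ⟩
  ∣ A ^ M - B ^ M ∣                            ≤⟨ ^-difference M 1≤L ∣A∣≤L ∣B∣≤L ⟩
  ι M * L ^ M * ∣ A - B ∣                      ≤⟨ *-mono-≤ (*-nonneg (0≤ι M) 0≤L^M) (0≤∣p∣ (A - B))
                                                   (*-monoˡ-≤-nonNeg (ι M) {{nonNegative (0≤ι M)}} L^M≤C) ∣A-B∣≤ ⟩
  ι M * C * ((K * h) * (K * h) * C)            ≡⟨ lem₃ (ι M) C K h ⟩
  C * (K * K * C) * h * (ι M * h)              ≡⟨ trans (cong (C * (K * K * C) * h *_) (ι*inv m)) (*-identityʳ _) ⟩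
  C * (K * K * C) * h                          ∎
  where
  open ≤-Reasoning
  k = n ℕ.+ m ℕ.* suc n
  M = suc m
  N = suc n
  h = inv m
  g = inv k
  t = x * g
  A = (1ℚ + t) ^ N
  B = 1ℚ + ι N * t
  L = (1ℚ + K * g) ^ N
  0≤g : 0ℚ ≤ g
  0≤g = 0≤inv k
  N*g≡h : ι N * g ≡ h
  N*g≡h = trans (cong (ι N *_) (trans (inv-* m n) (*-comm h (inv n))))
    (trans (sym (*-assoc (ι N) (inv n) h)) (trans (cong (_* h) (ι*inv n)) (*-identityˡ h)))
  lem₁ : ∀ a b c → a * (b * c) ≡ b * (a * c)
  lem₁ = solve-∀ ring
  N*xg : ∀ y → ι N * (y * g) ≡ y * h
  N*xg y = trans (lem₁ (ι N) y g) (cong (y *_) N*g≡h)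
  B≡ : B ≡ 1ℚ + x * h
  B≡ = cong (1ℚ +_) (N*xg x)
  A^M≡ : expApprox k x ≡ A ^ M
  A^M≡ = trans (cong ((1ℚ + t) ^_) (ℕ.*-comm M N)) (sym (^-assocʳ (1ℚ + t) N M))
  1≤1+Kg : 1ℚ ≤ 1ℚ + K * g
  1≤1+Kg = p≤p+q (*-nonneg 0≤K 0≤g)
  1≤L : 1ℚ ≤ L
  1≤L = 1≤^ N 1≤1+Kg
  0≤L^M : 0ℚ ≤ L ^ M
  0≤L^M = ^-nonneg M (≤-trans 0≤1 1≤L)
  L^M≤C : L ^ M ≤ C
  L^M≤C = subst (_≤ C) (trans (cong ((1ℚ + K * g) ^_) (ℕ.*-comm M N)) (sym (^-assocʳ (1ℚ + K * g) N M))) (hC k)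
  ∣A∣≤L : ∣ A ∣ ≤ L
  ∣A∣≤L = ∣^∣≤ N (∣1+x*h∣≤ 0≤g hx)
  ∣B∣≤L : ∣ B ∣ ≤ L
  ∣B∣≤L = ≤-trans (subst (λ s → ∣ s ∣ ≤ 1ℚ + ι N * (K * g)) (sym B≡)
      (subst (λ s → ∣ 1ℚ + x * h ∣ ≤ 1ℚ + s) (sym (N*xg K)) (∣1+x*h∣≤ (0≤inv m) hx)))
    (bernoulli (K * g) N (*-nonneg 0≤K 0≤g))
  ∣t∣≤ : ∣ t ∣ ≤ K * g
  ∣t∣≤ = subst (_≤ K * g) (sym (trans (∣p*q∣≡∣p∣*∣q∣ x g) (cong (∣ x ∣ *_) (0≤p⇒∣p∣≡p 0≤g))))
    (*-monoʳ-≤-nonNeg g {{nonNegative 0≤g}} hx)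
  N∣t∣≤ : ι N * ∣ t ∣ ≤ K * h
  N∣t∣≤ = subst (ι N * ∣ t ∣ ≤_) (N*xg K) (*-monoˡ-≤-nonNeg (ι N) {{nonNegative (0≤ι N)}} ∣t∣≤)
  0≤N∣t∣ : 0ℚ ≤ ι N * ∣ t ∣
  0≤N∣t∣ = *-nonneg (0≤ι N) (0≤∣p∣ t)
  0≤1+∣t∣ : 0ℚ ≤ 1ℚ + ∣ t ∣
  0≤1+∣t∣ = +-nonneg 0≤1 (0≤∣p∣ t)
  L≤C : L ≤ C
  L≤C = ≤-trans (x≤x^1+n m 1≤L) L^M≤C
  ∣A-B∣≤ : ∣ A - B ∣ ≤ (K * h) * (K * h) * C
  ∣A-B∣≤ = ≤-trans (^-second-order t N)
    (*-mono-≤ (*-nonneg 0≤N∣t∣ 0≤N∣t∣) (^-nonneg N 0≤1+∣t∣)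
      (*-mono-≤ 0≤N∣t∣ 0≤N∣t∣ N∣t∣≤ N∣t∣≤)
      (≤-trans (^-mono N 0≤1+∣t∣ (+-monoʳ-≤ 1ℚ ∣t∣≤)) L≤C))
  lem₃ : ∀ a C K h → a * C * ((K * h) * (K * h) * C) ≡ C * (K * K * C) * h * (a * h)
  lem₃ = solve-∀ ring

abstract
  expApprox-converges : ConvergesLocally expApprox
  expApprox-converges K 0≤K = record
    { bound     = C + D
    ; 0≤bound   = +-nonneg 0≤C 0≤D
    ; lipschitz = λ n x y hx hy → ≤-trans (expApprox-lipschitz 0≤K hC n x y hx hy)
                    (*-monoʳ-≤-nonNeg ∣ x - y ∣ {{∣-∣-nonNeg (x - y)}} (p≤p+q {C} {D} 0≤D))
    ; uniform   = λ m n x hx → ≤-trans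
                    (via-common-refinement expApprox D x (expApprox-refine {K} {C} {x} 0≤K hC hx) m n)
                    (*-monoʳ-≤-nonNeg (inv m + inv n) {{nonNegative (+-nonneg (0≤inv m) (0≤inv n))}} (p≤q+p {D} {C} 0≤C))
    }
    where
    C : ℚ
    C = proj₁ (expApprox-bound K)
    hC : ∀ n → (1ℚ + K * inv n) ^ suc n ≤ C
    hC n = proj₂ (expApprox-bound K) n 0≤K
    0≤C : 0ℚ ≤ C
    0≤C = ≤-trans (^-nonneg 1 (+-nonneg 0≤1 (*-nonneg 0≤K (0≤inv 0)))) (hC 0)
    D : ℚ
    D = C * (K * K * C)
    0≤D : 0ℚ ≤ D
    0≤D = *-nonneg 0≤C (*-nonneg (*-nonneg 0≤K 0≤K) 0≤C)

exp : ℝ → ℝ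
exp = limit expApprox-converges

------------------------------------------------------------------------
-- log⁺ x = ∫₁^max(1,x) dt/t = max(0, log x). With c = max(1,x) - 1 and
-- N = n + 1 equal subintervals, the left Riemann sum is
-- ∑_{i<N} (c/N) / (1 + i c/N) = ∑_{i<N} c / (N + i c).

excess : ℚ → ℚ
excess x = (x ⊔ 1ℚ) - 1ℚ

0≤excess : ∀ x → 0ℚ ≤ excess x
0≤excess x = 0≤q-p (p≤q⊔p x 1ℚ)

0<node : ∀ n i {c} → 0ℚ ≤ c → 0ℚ < ι (suc n) + ι i * c
0<node n i 0≤c = +-pos-nonneg (0<ι n) (*-nonneg (0≤ι i) 0≤c)

logTerm : ∀ n i c → 0ℚ ≤ c → ℚ
logTerm n i c 0≤c = (c ÷ (ι (suc n) + ι i * c)) {{>-nonZero (0<node n i 0≤c)}}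

logApprox : ℕ → ℚ → ℚ
logApprox n x = ∑< (suc n) (λ i → logTerm n i (excess x) (0≤excess x))

excess-≤ : ∀ {x K} → 0ℚ ≤ K → ∣ x ∣ ≤ K → excess x ≤ K
excess-≤ {x} {K} 0≤K hx with ≤-total x 1ℚ
... | inj₁ x≤1 = subst (_≤ K) (sym (trans (cong (_- 1ℚ) (p≤q⇒p⊔q≡q x≤1)) (+-inverseʳ 1ℚ))) 0≤K
... | inj₂ 1≤x = subst (_≤ K) (sym (cong (_- 1ℚ) (p≥q⇒p⊔q≡p 1≤x)))
  (≤-trans (≤-trans (p≤p+q {x - 1ℚ} {1ℚ} 0≤1) (≤-reflexive (lem x))) (≤-trans (p≤∣p∣ x) hx))
  where
  lem : ∀ x → x - 1ℚ + 1ℚ ≡ x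
  lem = solve-∀ ring

excess-lipschitz : ∀ x y → ∣ excess x - excess y ∣ ≤ ∣ x - y ∣
excess-lipschitz x y = subst (λ s → ∣ s ∣ ≤ ∣ x - y ∣) (lem (x ⊔ 1ℚ) (y ⊔ 1ℚ) 1ℚ) (⊔-lip x y)
  where
  lem : ∀ a b c → a - b ≡ (a - c) - (b - c)
  lem = solve-∀ ring
  lem₂ : ∀ x y → (x - y) ≡ (x - 1ℚ) + (1ℚ - y)
  lem₂ = solve-∀ ring
  mixed : ∀ x y → x ≤ 1ℚ → 1ℚ ≤ y → ∣ y - 1ℚ ∣ ≤ ∣ y - x ∣
  mixed x y x≤1 1≤y = ≤-trans (≤-reflexive (0≤p⇒∣p∣≡p (0≤q-p 1≤y)))
    (≤-trans (subst (y - 1ℚ ≤_) (sym (lem₂ y x)) (p≤p+q {y - 1ℚ} {1ℚ - x} (0≤q-p x≤1))) (p≤∣p∣ (y - x)))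
  ⊔-lip : ∀ x y → ∣ (x ⊔ 1ℚ) - (y ⊔ 1ℚ) ∣ ≤ ∣ x - y ∣
  ⊔-lip x y with ≤-total x 1ℚ | ≤-total y 1ℚ
  ... | inj₁ x≤1 | inj₁ y≤1 = subst (_≤ ∣ x - y ∣)
      (sym (cong ∣_∣ (trans (cong₂ _-_ (p≤q⇒p⊔q≡q x≤1) (p≤q⇒p⊔q≡q y≤1)) (+-inverseʳ 1ℚ)))) (0≤∣p∣ (x - y))
  ... | inj₁ x≤1 | inj₂ 1≤y = subst₂ _≤_
      (trans (∣p-q∣≡∣q-p∣ y 1ℚ) (sym (cong ∣_∣ (cong₂ _-_ (p≤q⇒p⊔q≡q x≤1) (p≥q⇒p⊔q≡p 1≤y)))))
      (∣p-q∣≡∣q-p∣ y x) (mixed x y x≤1 1≤y)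
  ... | inj₂ 1≤x | inj₁ y≤1 = subst (_≤ ∣ x - y ∣)
      (sym (cong ∣_∣ (cong₂ _-_ (p≥q⇒p⊔q≡p 1≤x) (p≤q⇒p⊔q≡q y≤1)))) (mixed y x y≤1 1≤x)
  ... | inj₂ 1≤x | inj₂ 1≤y = ≤-reflexive (cong ∣_∣ (cong₂ _-_ (p≥q⇒p⊔q≡p 1≤x) (p≥q⇒p⊔q≡p 1≤y)))

reciprocal-nonneg : ∀ {D u} → 0ℚ < D → D * u ≡ 1ℚ → 0ℚ ≤ u
reciprocal-nonneg {D} {u} 0<D Du≡1 = *-cancelˡ-≤-pos D {{positive 0<D}}
  (subst₂ _≤_ (sym (*-zeroʳ D)) (sym Du≡1) 0≤1)

reciprocal-≤ : ∀ {n D u} → ι (suc n) ≤ D → D * u ≡ 1ℚ → u ≤ inv n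
reciprocal-≤ {n} {D} {u} N≤D Du≡1 = *-cancelˡ-≤-pos (ι (suc n)) {{positive (0<ι n)}}
  (subst (ι (suc n) * u ≤_) (trans Du≡1 (sym (ι*inv n)))
    (*-monoʳ-≤-nonNeg u {{nonNegative (reciprocal-nonneg (<-≤-trans (0<ι n) N≤D) Du≡1)}} N≤D))

logRecip : ∀ n i c → 0ℚ ≤ c → ℚ
logRecip n i c 0≤c = (1/ (ι (suc n) + ι i * c)) {{>-nonZero (0<node n i 0≤c)}}

node*logRecip : ∀ n i c (0≤c : 0ℚ ≤ c) → (ι (suc n) + ι i * c) * logRecip n i c 0≤c ≡ 1ℚ
node*logRecip n i c 0≤c = *-inverseʳ (ι (suc n) + ι i * c) {{>-nonZero (0<node n i 0≤c)}}

0≤logRecip : ∀ n i c (0≤c : 0ℚ ≤ c) → 0ℚ ≤ logRecip n i c 0≤c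
0≤logRecip n i c 0≤c = reciprocal-nonneg (0<node n i 0≤c) (node*logRecip n i c 0≤c)

logRecip-≤ : ∀ n i c (0≤c : 0ℚ ≤ c) → logRecip n i c 0≤c ≤ inv n
logRecip-≤ n i c 0≤c = reciprocal-≤ {n} (p≤p+q (*-nonneg (0≤ι i) 0≤c)) (node*logRecip n i c 0≤c)

logTerm-lipschitz : ∀ n i c d (0≤c : 0ℚ ≤ c) (0≤d : 0ℚ ≤ d) →
  ∣ logTerm n i c 0≤c - logTerm n i d 0≤d ∣ ≤ inv n * ∣ c - d ∣
logTerm-lipschitz n i c d 0≤c 0≤d = begin
  ∣ c * u - d * v ∣                          ≡⟨ cong ∣_∣ eq ⟩
  ∣ N * (u * v) * (c - d) ∣                  ≡⟨ ∣p*q∣≡∣p∣*∣q∣ (N * (u * v)) (c - d) ⟩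
  ∣ N * (u * v) ∣ * ∣ c - d ∣                ≡⟨ cong (_* ∣ c - d ∣) (0≤p⇒∣p∣≡p (*-nonneg (0≤ι (suc n)) (*-nonneg 0≤u 0≤v))) ⟩
  N * (u * v) * ∣ c - d ∣                    ≤⟨ *-monoʳ-≤-nonNeg ∣ c - d ∣ {{∣-∣-nonNeg (c - d)}}
                                                (*-monoˡ-≤-nonNeg N {{nonNegative (0≤ι (suc n))}}
                                                  (*-mono-≤ 0≤u 0≤v (logRecip-≤ n i c 0≤c) (logRecip-≤ n i d 0≤d))) ⟩
  N * (h * h) * ∣ c - d ∣                    ≡⟨ cong (_* ∣ c - d ∣) (trans (sym (*-assoc N h h)) (trans (cong (_* h) (ι*inv n)) (*-identityˡ h))) ⟩
  h * ∣ c - d ∣                              ∎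
  where
  open ≤-Reasoning
  N h u v : ℚ
  N = ι (suc n)
  h = inv n
  u = logRecip n i c 0≤c
  v = logRecip n i d 0≤d
  0≤u : 0ℚ ≤ u
  0≤u = 0≤logRecip n i c 0≤c
  0≤v : 0ℚ ≤ v
  0≤v = 0≤logRecip n i d 0≤d
  lem₁ : ∀ c u d v → c * u - d * v ≡ c * u * 1ℚ - d * v * 1ℚ
  lem₁ = solve-∀ ring
  lem₂ : ∀ N k c u d v → c * u * ((N + k * d) * v) - d * v * ((N + k * c) * u) ≡ N * (u * v) * (c - d)
  lem₂ = solve-∀ ring
  eq : c * u - d * v ≡ N * (u * v) * (c - d)
  eq = trans (lem₁ c u d v) (trans
    (cong₂ (λ s t → c * u * s - d * v * t) (sym (node*logRecip n i d 0≤d)) (sym (node*logRecip n i c 0≤c)))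
    (lem₂ N (ι i) c u d v))

logApprox-lipschitz : ∀ n x y → ∣ logApprox n x - logApprox n y ∣ ≤ ∣ x - y ∣
logApprox-lipschitz n x y = begin
  ∣ logApprox n x - logApprox n y ∣      ≤⟨ ∑<-difference (suc n)
      (λ i → logTerm n i (excess x) (0≤excess x)) (λ i → logTerm n i (excess y) (0≤excess y)) (inv n * e)
      (λ i _ → logTerm-lipschitz n i (excess x) (excess y) (0≤excess x) (0≤excess y)) ⟩
  ι (suc n) * (inv n * e)                ≡⟨ sym (*-assoc (ι (suc n)) (inv n) e) ⟩
  ι (suc n) * inv n * e                  ≡⟨ trans (cong (_* e) (ι*inv n)) (*-identityˡ e) ⟩
  e                                      ≤⟨ excess-lipschitz x y ⟩
  ∣ x - y ∣                              ∎
  where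
  open ≤-Reasoning
  e : ℚ
  e = ∣ excess x - excess y ∣

logTerm-refine : ∀ m n i j c (0≤c : 0ℚ ≤ c) → j ℕ.< suc n →
  ∣ logTerm m i c 0≤c * inv n - logTerm (n ℕ.+ m ℕ.* suc n) (i ℕ.* suc n ℕ.+ j) c 0≤c ∣
    ≤ inv n * (inv m * (c * c * inv m))
logTerm-refine m n i j c 0≤c j<N = begin
  ∣ c * u * h - c * v ∣                      ≡⟨ cong ∣_∣ eq ⟩
  ∣ c * c * (u * v) * (r * h) ∣              ≡⟨ 0≤p⇒∣p∣≡p (*-nonneg (*-nonneg 0≤c² (*-nonneg 0≤u 0≤v)) 0≤rh) ⟩
  c * c * (u * v) * (r * h)                  ≤⟨ *-mono-≤ (*-nonneg 0≤c² (*-nonneg 0≤u 0≤v)) 0≤rh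
                                                (*-monoˡ-≤-nonNeg (c * c) {{nonNegative 0≤c²}}
                                                  (*-mono-≤ 0≤u 0≤v (logRecip-≤ m i c 0≤c) (logRecip-≤ k l c 0≤c))) rh≤1 ⟩
  c * c * (g * inv k) * 1ℚ                   ≡⟨ cong (λ s → c * c * (g * s) * 1ℚ) (inv-* m n) ⟩
  c * c * (g * (g * h)) * 1ℚ                 ≡⟨ lem₃ c g h ⟩
  h * (g * (c * c * g))                      ∎
  where
  open ≤-Reasoning
  k l : ℕ
  k = n ℕ.+ m ℕ.* suc n
  l = i ℕ.* suc n ℕ.+ j
  N h g u v r : ℚ
  N = ι (suc n)
  h = inv n
  g = inv m
  u = logRecip m i c 0≤c
  v = logRecip k l c 0≤c
  r = ι j
  0≤c² : 0ℚ ≤ c * c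
  0≤c² = *-nonneg 0≤c 0≤c
  0≤u : 0ℚ ≤ u
  0≤u = 0≤logRecip m i c 0≤c
  0≤v : 0ℚ ≤ v
  0≤v = 0≤logRecip k l c 0≤c
  0≤rh : 0ℚ ≤ r * h
  0≤rh = *-nonneg (0≤ι j) (0≤inv n)
  rh≤1 : r * h ≤ 1ℚ
  rh≤1 = subst (r * h ≤_) (ι*inv n)
    (*-monoʳ-≤-nonNeg h {{nonNegative (0≤inv n)}} (ι-mono (ℕ.<⇒≤ j<N)))
  node≡ : ι (suc k) + ι l * c ≡ ι (suc m) * N + (ι i * N + r) * c
  node≡ = cong₂ (λ s t → s + t * c) (ι-* (suc m) (suc n))
    (trans (ι-+ (i ℕ.* suc n) j) (cong (_+ r) (ι-* i (suc n))))
  Dv≡1 : (ι (suc m) * N + (ι i * N + r) * c) * v ≡ 1ℚ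
  Dv≡1 = trans (cong (_* v) (sym node≡)) (node*logRecip k l c 0≤c)
  Du≡1 : (ι (suc m) + ι i * c) * u ≡ 1ℚ
  Du≡1 = node*logRecip m i c 0≤c
  lem₁ : ∀ c u v h → c * u * h - c * v ≡ c * u * h * 1ℚ - c * v * (1ℚ * 1ℚ)
  lem₁ = solve-∀ ring
  lem₂ : ∀ c u v h M N I r → c * u * h * ((M * N + (I * N + r) * c) * v) - c * v * ((M + I * c) * u * (N * h))
       ≡ c * c * (u * v) * (r * h)
  lem₂ = solve-∀ ring
  lem₃ : ∀ c g h → c * c * (g * (g * h)) * 1ℚ ≡ h * (g * (c * c * g))
  lem₃ = solve-∀ ring
  eq : c * u * h - c * v ≡ c * c * (u * v) * (r * h)
  eq = trans (lem₁ c u v h) (trans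
    (cong₂ (λ s t → c * u * h * s - c * v * t) (sym Dv≡1) (cong₂ _*_ (sym Du≡1) (sym (ι*inv n))))
    (lem₂ c u v h (ι (suc m)) N (ι i) r))

logApprox-refine : ∀ m n x →
  ∣ logApprox m x - logApprox (n ℕ.+ m ℕ.* suc n) x ∣ ≤ excess x * excess x * inv m
logApprox-refine m n x = begin
  ∣ logApprox m x - logApprox k x ∣      ≡⟨ cong (λ s → ∣ logApprox m x - s ∣) (∑<-* (suc m) (suc n) (λ l → logTerm k l c 0≤c)) ⟩
  ∣ ∑< (suc m) f - ∑< (suc m) f′ ∣       ≤⟨ ∑<-difference (suc m) f f′ (inv m * b) (λ i _ → block i) ⟩
  ι (suc m) * (inv m * b)                ≡⟨ collapse m b ⟩
  b                                      ∎
  where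
  open ≤-Reasoning
  k : ℕ
  k = n ℕ.+ m ℕ.* suc n
  c b : ℚ
  c = excess x
  b = c * c * inv m
  0≤c : 0ℚ ≤ c
  0≤c = 0≤excess x
  f f′ : ℕ → ℚ
  f  i = logTerm m i c 0≤c
  f′ i = ∑< (suc n) (λ j → logTerm k (i ℕ.* suc n ℕ.+ j) c 0≤c)
  collapse : ∀ n p → ι (suc n) * (inv n * p) ≡ p
  collapse n p = trans (sym (*-assoc (ι (suc n)) (inv n) p)) (trans (cong (_* p) (ι*inv n)) (*-identityˡ p))
  split : ∀ i → f i ≡ ∑< (suc n) (λ _ → f i * inv n)
  split i = sym (trans (∑<-const (suc n) (f i * inv n))
    (trans (cong (ι (suc n) *_) (*-comm (f i) (inv n))) (collapse n (f i))))
  block : ∀ i → ∣ f i - f′ i ∣ ≤ inv m * b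
  block i = begin
    ∣ f i - f′ i ∣                                  ≡⟨ cong (λ s → ∣ s - f′ i ∣) (split i) ⟩
    ∣ ∑< (suc n) (λ _ → f i * inv n) - f′ i ∣       ≤⟨ ∑<-difference (suc n) (λ _ → f i * inv n)
        (λ j → logTerm k (i ℕ.* suc n ℕ.+ j) c 0≤c) (inv n * (inv m * b))
        (λ j j<N → logTerm-refine m n i j c 0≤c j<N) ⟩
    ι (suc n) * (inv n * (inv m * b))               ≡⟨ collapse n (inv m * b) ⟩
    inv m * b                                       ∎

abstract
  logApprox-converges : ConvergesLocally logApprox
  logApprox-converges K 0≤K = record
    { bound     = 1ℚ + D
    ; 0≤bound   = +-nonneg 0≤1 0≤D
    ; lipschitz = λ n x y _ _ → ≤-trans (logApprox-lipschitz n x y)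
        (subst (_≤ (1ℚ + D) * ∣ x - y ∣) (*-identityˡ ∣ x - y ∣)
          (*-monoʳ-≤-nonNeg ∣ x - y ∣ {{∣-∣-nonNeg (x - y)}} (p≤p+q {1ℚ} {D} 0≤D)))
    ; uniform   = λ m n x hx → via-common-refinement logApprox (1ℚ + D) x
        (λ m n → ≤-trans (logApprox-refine m n x)
          (*-monoʳ-≤-nonNeg (inv m) {{nonNegative (0≤inv m)}}
            (≤-trans (*-mono-≤ (0≤excess x) (0≤excess x) (excess-≤ 0≤K hx) (excess-≤ 0≤K hx)) (p≤q+p {D} {1ℚ} 0≤1))))
        m n
    }
    where
    D : ℚ
    D = K * K
    0≤D : 0ℚ ≤ D
    0≤D = *-nonneg 0≤K 0≤K

log⁺ : ℝ → ℝ
log⁺ = limit logApprox-converges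

-- a ^ y = exp (y log a), for bases a > 1 only: this is where log⁺ agrees
-- with log.
pow : (a : ℝ) → 1ᴿ <ᴿ a → ℝ → ℝ
pow a _ y = exp (y *ᴿ log⁺ a)

-- A real-valued function whose domain is a subset of ℝ.
record RealFunction : Set₁ where
  field
    Domain      : ℝ → Set
    Domain-resp : ∀ {x y} → x ≈ᴿ y → Domain x → Domain y
    apply       : ∀ x → Domain x → ℝ
    apply-cong  : ∀ {x y} (p : Domain x) (q : Domain y) → x ≈ᴿ y → apply x p ≈ᴿ apply y q

record _∈𝓕 (f : RealFunction) : Set where
  open RealFunction f
  field
    ℕ⊆Domain : ∀ k → Domain (fromℕ k)

  at : ℕ → ℝ
  at k = apply (fromℕ k) (ℕ⊆Domain k)

  field
    vanishes : at 0 ≈ᴿ 0ᴿ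
    convex   : ∀ k → at (suc k) -ᴿ at k <ᴿ at (suc (suc k)) -ᴿ at (suc k)
    growth   : ∀ k → 3 ℕ.≤ k →
               fromℕ k *ᴿ (at (k ℕ.∸ 1) -ᴿ at 1) ≤ᴿ (fromℕ k -ᴿ fromℕ 2) *ᴿ at k

-- x ↦ a ^ (l x) - 1 on the half-line x ≥ 0.
exponential-1 : (a l : ℝ) → 1ᴿ <ᴿ a → RealFunction
exponential-1 a l 1<a = record
  { Domain      = 0ᴿ ≤ᴿ_
  ; Domain-resp = λ {x} {y} → ≤ᴿ-respʳ {0ᴿ} {x} {y}
  ; apply       = λ x _ → pow a 1<a (l *ᴿ x) -ᴿ 1ᴿ
  ; apply-cong  = λ {x} {y} _ _ x≈y → -ᴿ-congˡ {pow a 1<a (l *ᴿ x)} {pow a 1<a (l *ᴿ y)} 1ᴿ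
      (limit-cong expApprox-converges {(l *ᴿ x) *ᴿ log⁺ a} {(l *ᴿ y) *ᴿ log⁺ a}
        (*ᴿ-cong {l *ᴿ x} {l *ᴿ y} {log⁺ a} {log⁺ a} (*ᴿ-cong {l} {l} {x} {y} (≈ᴿ-refl {l}) x≈y) (≈ᴿ-refl {log⁺ a})))
  }

{-# OPTIONS --safe #-}
-- Put b = exp (l log a) > 1, so that f k = b ^ k - 1.  Then
-- f (k + 2) - 2 f (k + 1) + f k = b ^ k (b - 1)², and the growth condition at
-- k = m + 2 says that D m = m (b ^ (m + 2) - 1) - (m + 2) (b ^ (m + 1) - b) is
-- nonnegative; this follows by induction from
-- D (m + 1) = b D m + (b - 1) (b ^ (m + 2) - 1 - (m + 2) (b - 1))
-- and Bernoulli's inequality.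
module Submission where

open import Defs
open import Algebra.Bundles using (CommutativeRing)
open import Data.Nat.Base as ℕ using (ℕ; zero; suc)
import Data.Nat.Properties as ℕ
open import Data.Product using (∃; _×_; _,_)
open import Data.Rational
open import Data.Rational.Properties
open import Relation.Binary.PropositionalEquality
open import Relation.Nullary.Decidable using (dec⇒maybe)
open import Tactic.RingSolver using (solve-∀)
open import Tactic.RingSolver.Core.AlmostCommutativeRing
  using (AlmostCommutativeRing; fromCommutativeRing)
open import Algebra.Definitions.RawSemiring +-*-rawSemiring using (_^_)
open import Algebra.Properties.Semiring.Exp
  (CommutativeRing.semiring +-*-commutativeRing) using (^-assocʳ)

private
  ring : AlmostCommutativeRing _ _
  ring = fromCommutativeRing +-*-commutativeRing (λ x → dec⇒maybe (0ℚ ≟ x))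

-- Rearranging rational inequalities

p<q+ε : ∀ {p q ε} → ∣ p - q ∣ < ε → p < q + ε
p<q+ε {p} {q} {ε} h = begin-strict
  p               ≡⟨ lem p q ⟩
  q + (p - q)     ≤⟨ +-monoʳ-≤ q (p≤∣p∣ (p - q)) ⟩
  q + ∣ p - q ∣   <⟨ +-monoʳ-< q h ⟩
  q + ε           ∎
  where
  open ≤-Reasoning
  lem : ∀ p q → p ≡ q + (p - q)
  lem = solve-∀ ring

p+q≤r⇒q≤r-p : ∀ {p q r} → p + q ≤ r → q ≤ r - p
p+q≤r⇒q≤r-p {p} {q} {r} h = subst (_≤ r - p) (lem p q) (+-monoˡ-≤ (- p) h)
  where
  lem : ∀ p q → p + q - p ≡ q
  lem = solve-∀ ring

-- The growth inequality for rational powers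

growth-poly : ∀ {b} m → 1ℚ ≤ b → ι (2 ℕ.+ m) * (b ^ suc m - b) ≤ ι m * (b ^ (2 ℕ.+ m) - 1ℚ)
-- The induction starts at k = 2, where both sides are 0.
growth-poly {b} zero    1≤b = ≤-reflexive (lem (ι 2) b (b ^ 2))
  where
  lem : ∀ c b d → c * (b * 1ℚ - b) ≡ 0ℚ * (d - 1ℚ)
  lem = solve-∀ ring
growth-poly {b} (suc m) 1≤b = begin
  ι (3 ℕ.+ m) * (b * P - b)                               ≡⟨ cong (_* (b * P - b)) ι3+m ⟩
  -- The two summands added are b D m, nonnegative by the induction hypothesis, and the Bernoulli
  -- remainder times b - 1. Casts are written out in terms of `ι m` so that the recurrence for D
  -- becomes a polynomial identity.
  (1ℚ + (1ℚ + (1ℚ + ι m))) * (b * P - b)                  ≤⟨ p≤p+q (+-nonneg 0≤bD 0≤rest) ⟩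
  (1ℚ + (1ℚ + (1ℚ + ι m))) * (b * P - b)
    + (b * (ι m * (b * P - 1ℚ) - (1ℚ + (1ℚ + ι m)) * (P - b))
      + (b - 1ℚ) * (b * P - (1ℚ + (1ℚ + (1ℚ + ι m)) * (b - 1ℚ))))
                                                          ≡⟨ lem (ι m) b P ⟩
  (1ℚ + ι m) * (b * (b * P) - 1ℚ)                         ≡⟨ cong (_* (b * (b * P) - 1ℚ)) (sym (ι-suc m)) ⟩
  ι (suc m) * (b * (b * P) - 1ℚ)                          ∎
  where
  open ≤-Reasoning
  P : ℚ
  P = b ^ suc m
  ι2+m : ι (2 ℕ.+ m) ≡ 1ℚ + (1ℚ + ι m)
  ι2+m = trans (ι-suc (suc m)) (cong (1ℚ +_) (ι-suc m))
  ι3+m : ι (3 ℕ.+ m) ≡ 1ℚ + (1ℚ + (1ℚ + ι m))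
  ι3+m = trans (ι-suc (2 ℕ.+ m)) (cong (1ℚ +_) ι2+m)
  0≤s : 0ℚ ≤ b - 1ℚ
  0≤s = 0≤q-p 1≤b
  1+s≡b : ∀ b → 1ℚ + (b - 1ℚ) ≡ b
  1+s≡b = solve-∀ ring
  0≤bD : 0ℚ ≤ b * (ι m * (b * P - 1ℚ) - (1ℚ + (1ℚ + ι m)) * (P - b))
  0≤bD = *-nonneg (≤-trans 0≤1 1≤b)
    (0≤q-p (subst (λ c → c * (P - b) ≤ ι m * (b * P - 1ℚ)) ι2+m (growth-poly m 1≤b)))
  0≤rest : 0ℚ ≤ (b - 1ℚ) * (b * P - (1ℚ + (1ℚ + (1ℚ + ι m)) * (b - 1ℚ)))
  -- Bernoulli with increment b - 1 and exponent m + 2; `b * P` is that power of b.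
  0≤rest = *-nonneg 0≤s (0≤q-p (subst₂ (λ c d → 1ℚ + c * (b - 1ℚ) ≤ d ^ (2 ℕ.+ m)) ι2+m (1+s≡b b)
    (bernoulli (b - 1ℚ) (2 ℕ.+ m) 0≤s)))
  lem : ∀ k b P → (1ℚ + (1ℚ + (1ℚ + k))) * (b * P - b)
      + (b * (k * (b * P - 1ℚ) - (1ℚ + (1ℚ + k)) * (P - b))
        + (b - 1ℚ) * (b * P - (1ℚ + (1ℚ + (1ℚ + k)) * (b - 1ℚ))))
    ≡ (1ℚ + k) * (b * (b * P) - 1ℚ)
  lem = solve-∀ ring

-- Bounds and a power law for the approximants of log and exp

∑<-≥ : ∀ n (f : ℕ → ℚ) b → (∀ i → i ℕ.< n → b ≤ f i) → ι n * b ≤ ∑< n f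
∑<-≥ zero    f b h = ≤-reflexive (*-zeroˡ b)
∑<-≥ (suc n) f b h = begin
  ι (suc n) * b                   ≡⟨ cong (_* b) (ι-suc n) ⟩
  (1ℚ + ι n) * b                  ≡⟨ lem (ι n) b ⟩
  b + ι n * b                     ≤⟨ +-mono-≤ (h 0 (ℕ.s≤s ℕ.z≤n))
                                       (∑<-≥ n (λ i → f (suc i)) b (λ i i<n → h (suc i) (ℕ.s≤s i<n))) ⟩
  ∑< (suc n) f                    ∎
  where
  open ≤-Reasoning
  lem : ∀ k b → (1ℚ + k) * b ≡ b + k * b
  lem = solve-∀ ring

-- With N = n + 1, the bounds i ≤ N and c ≤ K make the denominator N + i c at most N (1 + K), while
-- the numerator c is at least (1 + K) w. The proof clears the denominator.
logTerm-≥ : ∀ {n i c w K} (0≤c : 0ℚ ≤ c) → i ℕ.≤ suc n → c ≤ K → 0ℚ ≤ w → (1ℚ + K) * w ≤ c →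
            inv n * w ≤ logTerm n i c 0≤c
logTerm-≥ {n} {i} {c} {w} {K} 0≤c i≤N c≤K 0≤w Kw≤c = *-cancelˡ-≤-pos D {{positive (0<node n i 0≤c)}} (begin
  D * (inv n * w)                   ≤⟨ *-monoʳ-≤-nonNeg (inv n * w) {{nonNegative (*-nonneg (0≤inv n) 0≤w)}} D≤ ⟩
  (N + N * K) * (inv n * w)         ≡⟨ lem₁ N K (inv n) w ⟩
  N * inv n * ((1ℚ + K) * w)        ≡⟨ trans (cong (_* ((1ℚ + K) * w)) (ι*inv n)) (*-identityˡ _) ⟩
  (1ℚ + K) * w                      ≤⟨ Kw≤c ⟩
  c                                 ≡⟨ sym (*-identityʳ c) ⟩
  c * 1ℚ                            ≡⟨ cong (c *_) (sym (node*logRecip n i c 0≤c)) ⟩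
  c * (D * logRecip n i c 0≤c)      ≡⟨ lem₂ c D (logRecip n i c 0≤c) ⟩
  D * logTerm n i c 0≤c             ∎)
  where
  open ≤-Reasoning
  N D : ℚ
  N = ι (suc n)
  D = N + ι i * c
  D≤ : D ≤ N + N * K
  D≤ = +-monoʳ-≤ N (*-mono-≤ (0≤ι i) 0≤c (ι-mono i≤N) c≤K)
  lem₁ : ∀ N K h w → (N + N * K) * (h * w) ≡ N * h * ((1ℚ + K) * w)
  lem₁ = solve-∀ ring
  lem₂ : ∀ c d u → c * (d * u) ≡ d * (c * u)
  lem₂ = solve-∀ ring

-- Each of the n + 1 terms is at least w / (n + 1). The bound does not depend on n, so it survives
-- in the limit and yields log a > 0.
logApprox-≥ : ∀ {x w K} n → excess x ≤ K → 0ℚ ≤ w → (1ℚ + K) * w ≤ excess x → w ≤ logApprox n x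
logApprox-≥ {x} {w} n x≤K 0≤w Kw≤x = begin
  w                         ≡⟨ sym (*-identityˡ w) ⟩
  1ℚ * w                    ≡⟨ cong (_* w) (sym (ι*inv n)) ⟩
  ι (suc n) * inv n * w     ≡⟨ *-assoc (ι (suc n)) (inv n) w ⟩
  ι (suc n) * (inv n * w)   ≤⟨ ∑<-≥ (suc n) (λ i → logTerm n i (excess x) (0≤excess x)) (inv n * w)
                                 (λ i i<N → logTerm-≥ {n} {i} (0≤excess x) (ℕ.<⇒≤ i<N) x≤K 0≤w Kw≤x) ⟩
  logApprox n x             ∎
  where open ≤-Reasoning

-- Bernoulli with increment x / (n + 1) and exponent n + 1. Again the bound is uniform in n.
expApprox-≥ : ∀ {x} n → 0ℚ ≤ x → 1ℚ + x ≤ expApprox n x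
expApprox-≥ {x} n 0≤x = subst (λ y → 1ℚ + y ≤ expApprox n x) eq
  (bernoulli (x * inv n) (suc n) (*-nonneg 0≤x (0≤inv n)))
  where
  lem : ∀ k x h → k * (x * h) ≡ k * h * x
  lem = solve-∀ ring
  eq : ι (suc n) * (x * inv n) ≡ x
  eq = trans (lem (ι (suc n)) x (inv n)) (trans (cong (_* x) (ι*inv n)) (*-identityˡ x))

-- The successor of the index on the left computes to `suc n ℕ.* suc j`, so the factor j + 1 cancels
-- between the argument and the step size and remains only in the exponent.
expApprox-ι* : ∀ n j x → expApprox (j ℕ.+ n ℕ.* suc j) (ι (suc j) * x) ≡ expApprox n x ^ suc j
expApprox-ι* n j x = trans (cong (λ t → (1ℚ + t) ^ (suc n ℕ.* suc j)) eq)
  (sym (^-assocʳ (1ℚ + x * inv n) (suc n) (suc j)))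
  where
  lem : ∀ k x g h → k * x * (g * h) ≡ x * g * (k * h)
  lem = solve-∀ ring
  eq : ι (suc j) * x * inv (j ℕ.+ n ℕ.* suc j) ≡ x * inv n
  eq = begin
    ι (suc j) * x * inv (j ℕ.+ n ℕ.* suc j)   ≡⟨ cong (ι (suc j) * x *_) (inv-* n j) ⟩
    ι (suc j) * x * (inv n * inv j)           ≡⟨ lem (ι (suc j)) x (inv n) (inv j) ⟩
    x * inv n * (ι (suc j) * inv j)           ≡⟨ cong (x * inv n *_) (ι*inv j) ⟩
    x * inv n * 1ℚ                            ≡⟨ *-identityʳ _ ⟩
    x * inv n                                 ∎
    where open ≡-Reasoning

-- Equality and order of the reals

eventually-map : ∀ {P Q : ℕ → Set} → (∀ n → P n → Q n) → Eventually P → Eventually Q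
eventually-map f (N , p) = N , λ n N≤n → f n (p n N≤n)

≡⇒≈ᴿ : ∀ {x y} → (∀ n → seq x n ≡ seq y n) → x ≈ᴿ y
≡⇒≈ᴿ {x} {y} h ε 0<ε = 0 , λ n _ → subst (_< ε)
  (sym (cong ∣_∣ (trans (cong (_- seq y n) (h n)) (+-inverseʳ (seq y n))))) 0<ε

≈ᴿ-sym : ∀ {x y} → x ≈ᴿ y → y ≈ᴿ x
≈ᴿ-sym {x} {y} h ε 0<ε = eventually-map (λ n → subst (_< ε) (∣p-q∣≡∣q-p∣ (seq x n) (seq y n))) (h ε 0<ε)

≈ᴿ-trans : ∀ {x y z} → x ≈ᴿ y → y ≈ᴿ z → x ≈ᴿ z
≈ᴿ-trans {x} {y} {z} g h ε 0<ε with halve ε 0<ε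
... | δ , 0<δ , 2δ<ε = eventually-map
  (λ n (p , q) → ≤-<-trans (∣p-r∣≤∣p-q∣+∣q-r∣ (seq x n) (seq y n) (seq z n)) (<-trans (+-mono-< p q) 2δ<ε))
  (eventually-× (g δ 0<δ) (h δ 0<δ))

-ᴿ-cong : ∀ {x x′ y y′} → x ≈ᴿ x′ → y ≈ᴿ y′ → x -ᴿ y ≈ᴿ x′ -ᴿ y′
-ᴿ-cong {x} {x′} {y} {y′} g h ε 0<ε with halve ε 0<ε
... | δ , 0<δ , 2δ<ε = eventually-map
  (λ n (p , q) → subst (λ t → ∣ t ∣ < ε) (lem (seq x n) (seq x′ n) (seq y n) (seq y′ n))
    (≤-<-trans (∣p+q∣≤∣p∣+∣q∣ (seq x n - seq x′ n) (seq y′ n - seq y n))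
      (<-trans (+-mono-< p (subst (_< δ) (∣p-q∣≡∣q-p∣ (seq y n) (seq y′ n)) q)) 2δ<ε)))
  (eventually-× (g δ 0<δ) (h δ 0<δ))
  where
  lem : ∀ a b c d → (a - b) + (d - c) ≡ (a - c) - (b - d)
  lem = solve-∀ ring

≤ᴿ-respˡ : ∀ {x y z} → x ≈ᴿ y → y ≤ᴿ z → x ≤ᴿ z
≤ᴿ-respˡ {x} {y} {z} x≈y y≤z ε 0<ε with halve ε 0<ε
... | δ , 0<δ , 2δ<ε = eventually-map
  (λ n (p , q) → begin-strict
    seq x n              <⟨ p<q+ε {seq x n} {seq y n} p ⟩
    seq y n + δ          <⟨ +-monoˡ-< δ q ⟩
    seq z n + δ + δ      ≡⟨ +-assoc (seq z n) δ δ ⟩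
    seq z n + (δ + δ)    <⟨ +-monoʳ-< (seq z n) 2δ<ε ⟩
    seq z n + ε          ∎)
  (eventually-× (x≈y δ 0<δ) (y≤z δ 0<δ))
  where open ≤-Reasoning

<ᴿ-resp-≈ᴿ : ∀ {x x′ y y′} → x ≈ᴿ x′ → y ≈ᴿ y′ → x′ <ᴿ y′ → x <ᴿ y
-- The old gap ε pays for three shares of δ: one for each of the two replacements, and one that
-- remains as the new gap.
<ᴿ-resp-≈ᴿ {x} {x′} {y} {y′} x≈ y≈ (ε , 0<ε , x′<y′) with shrink (ι 3) ε (0≤ι 3) 0<ε
... | δ , 0<δ , 3δ<ε = δ , 0<δ , eventually-map
  (λ n ((p , q) , r) → +-cancelʳ-< δ (begin-strict
    seq x n + δ + δ              <⟨ +-monoˡ-< δ (+-monoˡ-< δ (p<q+ε {seq x n} {seq x′ n} p)) ⟩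
    seq x′ n + δ + δ + δ         ≡⟨ lem (seq x′ n) δ ⟩
    seq x′ n + ι 3 * δ           <⟨ +-monoʳ-< (seq x′ n) 3δ<ε ⟩
    seq x′ n + ε                 <⟨ r ⟩
    seq y′ n                     <⟨ p<q+ε {seq y′ n} {seq y n} (subst (_< δ) (∣p-q∣≡∣q-p∣ (seq y n) (seq y′ n)) q) ⟩
    seq y n + δ                  ∎))
  (eventually-× (eventually-× (x≈ δ 0<δ) (y≈ δ 0<δ)) x′<y′)
  where
  open ≤-Reasoning
  +-cancelʳ-< : ∀ r {p q} → p + r < q + r → p < q
  +-cancelʳ-< r {p} {q} h = subst₂ _<_ (cancel p r) (cancel q r) (+-monoˡ-< (- r) h)
    where
    cancel : ∀ p r → p + r - r ≡ p
    cancel = solve-∀ ring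
  lem : ∀ x d → x + d + d + d ≡ x + (1ℚ + 1ℚ + 1ℚ) * d
  lem = solve-∀ ring

eventually-≤⇒≤ᴿ : ∀ {x y} → Eventually (λ n → seq x n ≤ seq y n) → x ≤ᴿ y
eventually-≤⇒≤ᴿ {x} {y} h ε 0<ε = eventually-map
  (λ n p → subst (_< seq y n + ε) (+-identityʳ (seq x n)) (+-mono-≤-< p 0<ε)) h

-- `_<ᴿ_` demands strictness beyond the gap, whereas termwise estimates give weak inequalities; a
-- smaller gap makes up the difference.
gap⇒<ᴿ : ∀ {x y} ε → 0ℚ < ε → Eventually (λ n → seq x n + ε ≤ seq y n) → x <ᴿ y
gap⇒<ᴿ {x} {y} ε 0<ε h with halve ε 0<ε
... | δ , 0<δ , 2δ<ε = δ , 0<δ , eventually-map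
  (λ n p → <-≤-trans (+-monoʳ-< (seq x n) (≤-<-trans (p≤p+q (<⇒≤ 0<δ)) 2δ<ε)) p) h

0<ᴿ⇒eventually-≥ : ∀ {x} → 0ᴿ <ᴿ x → ∃ λ ε → 0ℚ < ε × Eventually (λ n → ε ≤ seq x n)
0<ᴿ⇒eventually-≥ {x} (ε , 0<ε , h) = ε , 0<ε , eventually-map
  (λ n p → <⇒≤ (subst (_< seq x n) (+-identityˡ ε) p)) h

-- Positivity of products and of log, and exp x > 1

0<ᴿx*ᴿy : ∀ {x y} → 0ᴿ <ᴿ x → 0ᴿ <ᴿ y → 0ᴿ <ᴿ x *ᴿ y
0<ᴿx*ᴿy {x} {y} 0<x 0<y with 0<ᴿ⇒eventually-≥ {x} 0<x | 0<ᴿ⇒eventually-≥ {y} 0<y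
... | ε , 0<ε , g | δ , 0<δ , h = gap⇒<ᴿ {0ᴿ} {x *ᴿ y} (ε * δ) (*-pos 0<ε 0<δ) (eventually-map
  (λ n (p , q) → subst (_≤ seq x n * seq y n) (sym (+-identityˡ (ε * δ))) (*-mono-≤ (<⇒≤ 0<ε) (<⇒≤ 0<δ) p q))
  (eventually-× g h))

0<ᴿlog⁺ : ∀ {x} → 1ᴿ <ᴿ x → 0ᴿ <ᴿ log⁺ x
0<ᴿlog⁺ {x} (ε , 0<ε , 1+ε<x) =
  -- K eventually bounds the excess of x over 1 from above and ε bounds it from below, so any w with
  -- (1 + K) w < ε meets the hypotheses of `logApprox-≥`.
  let K , 0≤K , x≤K = eventually-bounded x
      w , 0<w , Kw<ε = shrink (1ℚ + K) ε (+-nonneg 0≤1 0≤K) 0<ε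
  in gap⇒<ᴿ {0ᴿ} {log⁺ x} w 0<w (eventually-map
    (λ n (p , q) → subst (_≤ logApprox n (seq x n)) (sym (+-identityˡ w))
      (logApprox-≥ {seq x n} {w} {K} n (excess-≤ {seq x n} {K} 0≤K q) (<⇒≤ 0<w)
        (≤-trans (<⇒≤ Kw<ε) (ε≤excess p))))
    (eventually-× 1+ε<x x≤K))
  where
  ε≤excess : ∀ {y} → 1ℚ + ε < y → ε ≤ excess y
  ε≤excess {y} h = p+q≤r⇒q≤r-p {1ℚ} {ε} {y ⊔ 1ℚ} (≤-trans (<⇒≤ h) (p≤p⊔q y 1ℚ))

1<ᴿexp : ∀ {x} → 0ᴿ <ᴿ x → 1ᴿ <ᴿ exp x
1<ᴿexp {x} 0<x =
  let ε , 0<ε , h = 0<ᴿ⇒eventually-≥ {x} 0<x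
  in gap⇒<ᴿ {1ᴿ} {exp x} ε 0<ε (eventually-map
    (λ n p → ≤-trans (+-monoʳ-≤ 1ℚ p) (expApprox-≥ {seq x n} n (≤-trans (<⇒≤ 0<ε) p))) h)

-- Natural powers of exp

infixr 8 _^ᴿ_

_^ᴿ_ : ℝ → ℕ → ℝ
x ^ᴿ zero  = 1ᴿ
x ^ᴿ suc k = x *ᴿ x ^ᴿ k

seq-^ᴿ : ∀ x k n → seq (x ^ᴿ k) n ≡ seq x n ^ k
seq-^ᴿ x zero    n = refl
seq-^ᴿ x (suc k) n = cong (seq x n *_) (seq-^ᴿ x k n)

-- Only the index of the approximant moves along σ; the argument stays `seq x n`. The `uniform`
-- estimate therefore bounds the difference by C (1 / (n + 1) + 1 / (σ n + 1)), which tends to 0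
-- because n ≤ σ n.
limit-subsequence : ∀ {F} (conv : ConvergesLocally F) x y (σ : ℕ → ℕ) → (∀ n → n ℕ.≤ σ n) →
  (∀ n → F (σ n) (seq x n) ≡ seq y n) → limit conv x ≈ᴿ y
limit-subsequence {F} conv x y σ n≤σn eq ε 0<ε with eventually-bounded x
... | K , 0≤K , A , a with conv K 0≤K
... | record { bound = C ; 0≤bound = 0≤C ; uniform = uni } with shrink C ε 0≤C 0<ε
... | δ , 0<δ , Cδ<ε with halve δ 0<δ
... | η , 0<η , 2η<δ with inv-small η 0<η
... | N , q = eventually-map
  (λ n (x≤K , N≤n) → begin-strict
    ∣ F n (seq x n) - seq y n ∣              ≡⟨ cong (λ t → ∣ F n (seq x n) - t ∣) (sym (eq n)) ⟩
    ∣ F n (seq x n) - F (σ n) (seq x n) ∣    ≤⟨ uni n (σ n) (seq x n) x≤K ⟩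
    C * (inv n + inv (σ n))                  ≤⟨ *-monoˡ-≤-nonNeg C {{nonNegative 0≤C}} (<⇒≤ (<-trans
                                                  (+-mono-< (q n N≤n) (q (σ n) (ℕ.≤-trans N≤n (n≤σn n)))) 2η<δ)) ⟩
    C * δ                                    <⟨ Cδ<ε ⟩
    ε                                        ∎)
  (eventually-× (A , a) (N , λ _ h → h))
  where open ≤-Reasoning

exp-fromℕ* : ∀ k x → exp (fromℕ k *ᴿ x) ≈ᴿ exp x ^ᴿ k
exp-fromℕ* zero x = ≡⇒≈ᴿ {exp (fromℕ 0 *ᴿ x)} {1ᴿ} (λ n → trans
  (cong (λ t → (1ℚ + t) ^ suc n) (lem (seq x n) (inv n))) (1^ (suc n)))
  where
  lem : ∀ x h → 0ℚ * x * h ≡ 0ℚ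
  lem = solve-∀ ring
  1^ : ∀ k → 1ℚ ^ k ≡ 1ℚ
  1^ zero    = refl
  1^ (suc k) = trans (*-identityˡ (1ℚ ^ k)) (1^ k)
-- The powers of the approximants to exp x are a subsequence of the
-- approximants to exp (k x), indexed by k (n + 1) - 1.
exp-fromℕ* (suc j) x = limit-subsequence expApprox-converges (fromℕ (suc j) *ᴿ x) (exp x ^ᴿ suc j)
  (λ n → j ℕ.+ n ℕ.* suc j)
  (λ n → ℕ.≤-trans (ℕ.m≤m*n n (suc j)) (ℕ.m≤n+m (n ℕ.* suc j) j))
  (λ n → trans (expApprox-ι* n j (seq x n)) (sym (seq-^ᴿ (exp x) (suc j) n)))

-- Convexity and growth for real powers

^ᴿ-convex : ∀ {b} → 1ᴿ <ᴿ b → ∀ k →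
  (b ^ᴿ suc k -ᴿ 1ᴿ) -ᴿ (b ^ᴿ k -ᴿ 1ᴿ) <ᴿ (b ^ᴿ suc (suc k) -ᴿ 1ᴿ) -ᴿ (b ^ᴿ suc k -ᴿ 1ᴿ)
^ᴿ-convex {b} (ε , 0<ε , 1+ε<b) k = gap⇒<ᴿ
  {(b ^ᴿ suc k -ᴿ 1ᴿ) -ᴿ (b ^ᴿ k -ᴿ 1ᴿ)} {(b ^ᴿ suc (suc k) -ᴿ 1ᴿ) -ᴿ (b ^ᴿ suc k -ᴿ 1ᴿ)}
  -- The second difference is b ^ k (b - 1)², and eventually b ^ k ≥ 1 and b - 1 ≥ ε; the gap is the
  -- product of these lower bounds.
  (1ℚ * (ε * ε)) (*-pos 0<1 (*-pos 0<ε 0<ε)) (eventually-map step 1+ε<b)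
  where
  open ≤-Reasoning
  lem : ∀ b P → (b * P - 1ℚ) - (P - 1ℚ) + P * ((b - 1ℚ) * (b - 1ℚ)) ≡ (b * (b * P) - 1ℚ) - (b * P - 1ℚ)
  lem = solve-∀ ring
  step : ∀ n → 1ℚ + ε < seq b n →
    seq ((b ^ᴿ suc k -ᴿ 1ᴿ) -ᴿ (b ^ᴿ k -ᴿ 1ᴿ)) n + 1ℚ * (ε * ε)
      ≤ seq ((b ^ᴿ suc (suc k) -ᴿ 1ᴿ) -ᴿ (b ^ᴿ suc k -ᴿ 1ᴿ)) n
  step n h = begin
    (β * P - 1ℚ) - (P - 1ℚ) + 1ℚ * (ε * ε)                   ≤⟨ +-monoʳ-≤ ((β * P - 1ℚ) - (P - 1ℚ))
        (*-mono-≤ 0≤1 (*-nonneg 0≤ε 0≤ε) 1≤P (*-mono-≤ 0≤ε 0≤ε ε≤β-1 ε≤β-1)) ⟩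
    (β * P - 1ℚ) - (P - 1ℚ) + P * ((β - 1ℚ) * (β - 1ℚ))      ≡⟨ lem β P ⟩
    (β * (β * P) - 1ℚ) - (β * P - 1ℚ)                        ∎
    where
    β P : ℚ
    β = seq b n
    P = seq (b ^ᴿ k) n
    0≤ε : 0ℚ ≤ ε
    0≤ε = <⇒≤ 0<ε
    ε≤β-1 : ε ≤ β - 1ℚ
    ε≤β-1 = p+q≤r⇒q≤r-p {1ℚ} {ε} {β} (<⇒≤ h)
    1≤P : 1ℚ ≤ P
    1≤P = subst (1ℚ ≤_) (sym (seq-^ᴿ b k n)) (1≤^ k (≤-trans (p≤p+q 0≤ε) (<⇒≤ h)))

-- The inequality holds termwise at every index where the approximant of b exceeds 1 + ε, by
-- `growth-poly`; the rest reconciles the two shapes.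
^ᴿ-growth : ∀ {b} → 1ᴿ <ᴿ b → ∀ m →
  fromℕ (2 ℕ.+ m) *ᴿ ((b ^ᴿ suc m -ᴿ 1ᴿ) -ᴿ (b ^ᴿ 1 -ᴿ 1ᴿ))
    ≤ᴿ (fromℕ (2 ℕ.+ m) -ᴿ fromℕ 2) *ᴿ (b ^ᴿ (2 ℕ.+ m) -ᴿ 1ᴿ)
^ᴿ-growth {b} (ε , 0<ε , 1+ε<b) m = eventually-≤⇒≤ᴿ
  {fromℕ (2 ℕ.+ m) *ᴿ ((b ^ᴿ suc m -ᴿ 1ᴿ) -ᴿ (b ^ᴿ 1 -ᴿ 1ᴿ))}
  {(fromℕ (2 ℕ.+ m) -ᴿ fromℕ 2) *ᴿ (b ^ᴿ (2 ℕ.+ m) -ᴿ 1ᴿ)}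
  (eventually-map step 1+ε<b)
  where
  lem₁ : ∀ P b → P - b ≡ (P - 1ℚ) - (b * 1ℚ - 1ℚ)
  lem₁ = solve-∀ ring
  lem₂ : ∀ c k → k ≡ c + k - c
  lem₂ = solve-∀ ring
  step : ∀ n → 1ℚ + ε < seq b n →
    ι (2 ℕ.+ m) * ((seq (b ^ᴿ suc m) n - 1ℚ) - (seq b n * 1ℚ - 1ℚ))
      ≤ (ι (2 ℕ.+ m) - ι 2) * (seq (b ^ᴿ (2 ℕ.+ m)) n - 1ℚ)
  step n h = subst₂ _≤_
    (cong (ι (2 ℕ.+ m) *_) (trans (cong (_- seq b n) (sym (seq-^ᴿ b (suc m) n))) (lem₁ (seq (b ^ᴿ suc m) n) (seq b n))))
    -- The coefficient k - 2 is `ι m`, since k = m + 2.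
    (cong₂ (λ c P → c * (P - 1ℚ)) (trans (lem₂ (ι 2) (ι m)) (cong (_- ι 2) (sym (ι-+ 2 m)))) (sym (seq-^ᴿ b (2 ℕ.+ m) n)))
    (growth-poly m (≤-trans (p≤p+q (<⇒≤ 0<ε)) (<⇒≤ h)))

-- From powers of b to the exponential function

theorem7 : (a l : ℝ) (1<a : 1ᴿ <ᴿ a) → 0ᴿ <ᴿ l → exponential-1 a l 1<a ∈𝓕
theorem7 a l 1<a 0<l = record
  { ℕ⊆Domain = λ k → eventually-≤⇒≤ᴿ {0ᴿ} {fromℕ k} (0 , λ _ _ → 0≤ι k)
  ; vanishes = ≈ᴿ-trans {f 0} {1ᴿ -ᴿ 1ᴿ} {0ᴿ} (f≈ 0) (≡⇒≈ᴿ {1ᴿ -ᴿ 1ᴿ} {0ᴿ} (λ _ → refl))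
  ; convex   = λ k → <ᴿ-resp-≈ᴿ {f (suc k) -ᴿ f k} {g (suc k) -ᴿ g k}
      {f (suc (suc k)) -ᴿ f (suc k)} {g (suc (suc k)) -ᴿ g (suc k)}
      (-ᴿ-cong {f (suc k)} {g (suc k)} {f k} {g k} (f≈ (suc k)) (f≈ k))
      (-ᴿ-cong {f (suc (suc k))} {g (suc (suc k))} {f (suc k)} {g (suc k)} (f≈ (suc (suc k))) (f≈ (suc k)))
      (^ᴿ-convex {b} 1<b k)
  ; growth   = growth
  }
  where
  x b : ℝ
  x = l *ᴿ log⁺ a
  b = exp x
  f g : ℕ → ℝ
  f k = pow a 1<a (l *ᴿ fromℕ k) -ᴿ 1ᴿ
  g k = b ^ᴿ k -ᴿ 1ᴿ
  1<b : 1ᴿ <ᴿ b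
  1<b = 1<ᴿexp {x} (0<ᴿx*ᴿy {l} {log⁺ a} 0<l (0<ᴿlog⁺ {a} 1<a))
  lem : ∀ p k q → p * k * q ≡ k * (p * q)
  lem = solve-∀ ring
  f≈ : ∀ k → f k ≈ᴿ g k
  -- The exponent (l k) log a is regrouped as k (l log a), an exact identity at each index; then exp
  -- turns the factor k into a k-th power.
  f≈ k = -ᴿ-congˡ {pow a 1<a (l *ᴿ fromℕ k)} {b ^ᴿ k} 1ᴿ
    (≈ᴿ-trans {pow a 1<a (l *ᴿ fromℕ k)} {exp (fromℕ k *ᴿ x)} {b ^ᴿ k}
      (limit-cong expApprox-converges {l *ᴿ fromℕ k *ᴿ log⁺ a} {fromℕ k *ᴿ x}
        (≡⇒≈ᴿ {l *ᴿ fromℕ k *ᴿ log⁺ a} {fromℕ k *ᴿ x} (λ n → lem (seq l n) (ι k) (seq (log⁺ a) n))))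
      (exp-fromℕ* k x))
  growth : ∀ k → 3 ℕ.≤ k → fromℕ k *ᴿ (f (k ℕ.∸ 1) -ᴿ f 1) ≤ᴿ (fromℕ k -ᴿ fromℕ 2) *ᴿ f k
  growth (suc zero)    (ℕ.s≤s ())
  -- Two successors let `k ℕ.∸ 1` compute to `suc m` and put k in the form of `^ᴿ-growth`. The
  -- inequality for g is carried to f on each side separately.
  growth (suc (suc m)) _ = ≤ᴿ-respˡ
    {fromℕ k *ᴿ (f (suc m) -ᴿ f 1)} {fromℕ k *ᴿ (g (suc m) -ᴿ g 1)} {(fromℕ k -ᴿ fromℕ 2) *ᴿ f k}
    (*ᴿ-cong {fromℕ k} {fromℕ k} {f (suc m) -ᴿ f 1} {g (suc m) -ᴿ g 1} (≈ᴿ-refl {fromℕ k})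
      (-ᴿ-cong {f (suc m)} {g (suc m)} {f 1} {g 1} (f≈ (suc m)) (f≈ 1)))
    (≤ᴿ-respʳ {fromℕ k *ᴿ (g (suc m) -ᴿ g 1)} {(fromℕ k -ᴿ fromℕ 2) *ᴿ g k} {(fromℕ k -ᴿ fromℕ 2) *ᴿ f k}
      (*ᴿ-cong {fromℕ k -ᴿ fromℕ 2} {fromℕ k -ᴿ fromℕ 2} {g k} {f k}
        (≈ᴿ-refl {fromℕ k -ᴿ fromℕ 2}) (≈ᴿ-sym {f k} {g k} (f≈ k)))
      (^ᴿ-growth {b} 1<b m))
    where
    k : ℕ
    k = suc (suc m)
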